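{- For every integer $n\ge 1$, $$|\mathcal{S}_n(12;\,3\to 3)| = d_n + \sum_{m=1}^{n}\sum_{k=0}^{n-m}\binom{n-m}{k}\binom{m+k-1}{n-m}\, d_k,$$ where $d_j$ denotes the $j$-th derangement number.
   Context: $[n]=\{1,\dots,n\}$, and $\mathcal{S}_n$ is the set of permutations $\pi=\pi_1\pi_2\cdots\pi_n$ of $[n]$ in one-line notation. The permutation $\hat\pi$: for $\pi\in\mathcal{S}_n$, $\hat\pi\in\mathcal{S}_n$ is the permutation whose cycle form is obtained from the word $\pi_1\cdots\pi_n$ by inserting a left parenthesis before each left-to-right maximum (an entry larger than all entries to its left) and a right parenthesis immediately before the next left-to-right maximum, or at the end of the word. A cycle $(c_1,c_2,\dots,c_s)$ means $c_1\mapsto c_2\mapsto\cdots\mapsto c_s\mapsto c_1$. Example: if $\pi=2537164$ then $\hat\pi=(2)(53)(7164)$. Arrow patterns: an arrow pattern of size $k$ is a pair $(\nu;H)$ where $\nu=\nu_1\cdots\nu_m$ is a word of distinct positive integers, $H$ is a collection of arrows $b_i\to c_i$, and the set of all integers appearing in $\nu$ or $H$ is $[k]$. A permutation $\pi\in\mathcal{S}_n$ contains $(\nu;H)$ if there are a set $X=\{x_1<x_2<\cdots<x_k\}\subseteq[n]$ and indices $t_1<\cdots<t_m$ such that $\pi_{t_1}\pi_{t_2}\cdots\pi_{t_m}=x_{\nu_1}x_{\nu_2}\cdots x_{\nu_m}$ and $\hat\pi(x_{b_i})=x_{c_i}$ for every arrow $b_i\to c_i$ in $H$. Otherwise $\pi$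 avoids $(\nu;H)$. $\mathcal{S}_n(\nu;H)$ is the set of permutations in $\mathcal{S}_n$ avoiding $(\nu;H)$. The derangement number $d_j$ is the number of permutations of $[j]$ without fixed points ($d_0=1$, $d_1=0$). Binomial coefficients $\binom{a}{b}$ with $0\le a<b$ are $0$. -}

module Defs where

open import Data.Bool.Base using (if_then_else_)
open import Data.Fin.Base using (Fin; _<_)
open import Data.Fin.Patterns using (0F; 1F; 2F)
open import Data.Fin.Properties using (_≟_; _<?_; any?; all?)
open import Data.List.Base as List
  using (List; []; _∷_; allFin; cartesianProductWith; filter; foldr; length; upTo)
open import Data.List.NonEmpty.Base using (List⁺; _∷_)
import Data.List.Relation.Unary.All as ListAll
open import Data.List.Relation.Unary.Any using (Any; here; there)
open import Data.Nat.Base using (ℕ; zero; suc; _+_; _∸_)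
open import Data.Nat.ListAction using (sum)
open import Data.Product.Base using (∃; _×_; _,_; proj₂)
open import Data.Sum.Base using (_⊎_; inj₁; inj₂)
open import Data.Vec.Base as Vec using (Vec; []; _∷_; lookup; toList)
import Data.Vec.Properties as Vecₚ
import Data.Vec.Relation.Unary.Any as VecAny
import Data.Vec.Relation.Unary.All as VecAll
open import Data.Vec.Membership.Propositional using (_∈_)
open import Data.Vec.Relation.Unary.AllPairs as AllPairs using (AllPairs; []; _∷_)
open import Data.Vec.Relation.Unary.Unique.Propositional using (Unique)
open import Function.Base using (_∘_; id)
open import Relation.Binary.PropositionalEquality.Core using (_≡_; _≢_; refl)
open import Relation.Nullary.Decidable using (Dec; does; ¬?; _×-dec_; map′)
open import Relation.Nullary.Negation using (¬_)
open import Relation.Unary using (Pred; Decidable)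
open import Level using (0ℓ)

-- Throughout, Fin n stands for [n] = {1,…,n}, its element i for the
-- integer 1 + toℕ i.

-- A permutation is represented by its one-line notation: a word of length
-- n over [n] with distinct letters (hence containing every letter once).

Word : ℕ → Set
Word n = Vec (Fin n) n

unique? : ∀ {n m} → Decidable (Unique {A = Fin n} {m})
unique? = AllPairs.allPairs? (λ i j → ¬? (i ≟ j))

-- Each word is listed exactly once, so the length of a filtered list of
-- words is the cardinality of the set of words it selects.

words : ∀ n m → List (Vec (Fin n) m)
words n zero    = [] ∷ []
words n (suc m) = cartesianProductWith _∷_ (allFin n) (words n m)

𝒮 : ∀ n → List (Word n)
𝒮 n = filter unique? (words n n)

-- splitAtMaxima seen w, where seen lists the letters to the left of w,
-- yields the letters of w before its first left-to-right maximum, and the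
-- blocks of w that begin at left-to-right maxima.

splitAtMaxima : ∀ {n} → List (Fin n) → List (Fin n) →
                List (Fin n) × List (List⁺ (Fin n))
splitAtMaxima seen []      = [] , []
splitAtMaxima seen (x ∷ w) =
  let b , bs = splitAtMaxima (x ∷ seen) w in
  if does (ListAll.all? (_<? x) seen)
    then ([] , (x ∷ b) ∷ bs)
    else (x ∷ b , bs)

-- The very first letter is a left-to-right maximum, so that the first
-- component discarded here is empty.

cycles : ∀ {n} → Word n → List (List⁺ (Fin n))
cycles π = proj₂ (splitAtMaxima [] (toList π))

-- successor c₁ (cᵢ ∷ … ∷ c_s) sends cⱼ to cⱼ₊₁ for i ≤ j < s and c_s to c₁;
-- it fixes everything else.

successor : ∀ {n} → Fin n → List (Fin n) → Fin n → Fin n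
successor c₁ []           x = x
successor c₁ (c ∷ [])     x = if does (x ≟ c) then c₁ else x
successor c₁ (c ∷ d ∷ cs) x =
  if does (x ≟ c) then d else successor c₁ (d ∷ cs) x

cycleMap : ∀ {n} → List⁺ (Fin n) → Fin n → Fin n
cycleMap (c₁ ∷ cs) = successor c₁ (c₁ ∷ cs)

hat : ∀ {n} → Word n → Fin n → Fin n
hat π = foldr (λ c f → cycleMap c ∘ f) id (cycles π)

record ArrowPattern (k : ℕ) : Set where
  field
    {m}      : ℕ
    ν        : Vec (Fin k) m
    H        : List (Fin k × Fin k)
    distinct : Unique ν
    covers   : ∀ i → i ∈ ν ⊎ Any (λ (b , c) → i ≡ b ⊎ i ≡ c) H

Increasing : ∀ {n m} → Pred (Vec (Fin n) m) 0ℓ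
Increasing = AllPairs _<_

-- The set X = {x₁ < … < x_k} is given by the increasing vector of its
-- elements.

Contains : ∀ {n k} → Word n → ArrowPattern k → Set
Contains {n} {k} π P =
  ∃ λ (x : Vec (Fin n) k) → Increasing x ×
    (∃ λ (t : Vec (Fin n) m) → Increasing t ×
       Vec.map (lookup π) t ≡ Vec.map (lookup x) ν) ×
    ListAll.All (λ (b , c) → hat π (lookup x b) ≡ lookup x c) H
  where open ArrowPattern P

Avoids : ∀ {n k} → ArrowPattern k → Word n → Set
Avoids P π = ¬ Contains π P

anyVec? : ∀ {n} m {Q : Pred (Vec (Fin n) m) 0ℓ} → Decidable Q → Dec (∃ Q)
anyVec? zero    Q? = map′ ([] ,_) (λ { ([] , q) → q }) (Q? [])
anyVec? (suc m) Q? =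
  map′ (λ (i , v , q) → i ∷ v , q) (λ { (i ∷ v , q) → i , v , q })
       (any? λ i → anyVec? m λ v → Q? (i ∷ v))

increasing? : ∀ {n m} → Decidable (Increasing {n} {m})
increasing? = AllPairs.allPairs? _<?_

contains? : ∀ {n k} (π : Word n) (P : ArrowPattern k) → Dec (Contains π P)
contains? {k = k} π P =
  anyVec? k λ x → increasing? x ×-dec
    (anyVec? m λ t → increasing? t ×-dec
       Vecₚ.≡-dec _≟_ (Vec.map (lookup π) t) (Vec.map (lookup x) ν)) ×-dec
    ListAll.all? (λ (b , c) → hat π (lookup x b) ≟ lookup x c) H
  where open ArrowPattern P

avoids? : ∀ {n k} (P : ArrowPattern k) → Decidable (Avoids {n} P)
avoids? P π = ¬? (contains? π P)

𝒮⟨_⟩ : ∀ {k} → ArrowPattern k → ∀ n → List (Word n)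
𝒮⟨ P ⟩ n = filter (avoids? P) (𝒮 n)

[12⨾3→3] : ArrowPattern 3
[12⨾3→3] = record
  { ν        = 0F ∷ 1F ∷ []
  ; H        = (2F , 2F) ∷ []
  ; distinct = ((λ ()) VecAll.∷ VecAll.[]) ∷ VecAll.[] ∷ []
  ; covers   = λ where
      0F → inj₁ (VecAny.here refl)
      1F → inj₁ (VecAny.there (VecAny.here refl))
      2F → inj₂ (here (inj₁ refl))
  }

Derangement : ∀ {n} → Word n → Set
Derangement π = ∀ i → lookup π i ≢ i

derangement? : ∀ {n} → Decidable (Derangement {n})
derangement? π = all? λ i → ¬? (lookup π i ≟ i)

d : ℕ → ℕ
d j = length (filter derangement? (𝒮 j))

-- ∑[ a ⋯ b ] f is f a + f (a + 1) + … + f b, empty when b < a.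

∑[_⋯_] : ℕ → ℕ → (ℕ → ℕ) → ℕ
∑[ a ⋯ b ] f = sum (List.map (λ i → f (a + i)) (upTo (suc b ∸ a)))

{-# OPTIONS --safe #-}
module Submission where

-- A letter is fixed by π̂ exactly when it is isolated: a left-to-right maximum
-- that is followed by another one or ends the word. Hence π avoids the pattern
-- iff it has no isolated letter, or the letters below its largest isolated
-- letter m decrease.
--
-- Inserting a new smallest letter into a word of length N with x letters that
-- are not isolated changes x exactly as inserting a new element into the
-- cycles of a permutation changes its number of non-fixed points. So both
-- statistics are equidistributed on 𝒮 N, and there are C(N,k) d_k words with
-- x = k; in particular d_n words have no isolated letter.
--
-- A word with largest isolated letter m and decreasing letters below m arises
-- from a word w of the N = n - m larger letters by putting m in front and then
-- inserting m - 1 letters, one after the other, from left to right: in front of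
-- m or after a letter of w, and at least once after each isolated letter of w.
-- If k letters of w are not isolated, this can be done in C(m - 1 + k, N) ways.

open import Defs
open import Data.Bool.Base using (Bool; true; false; T; _∧_; not; if_then_else_)
open import Data.Bool.Properties using (T-∧; ∧-comm; ∧-zeroʳ)
open import Data.Empty using (⊥-elim)
open import Data.Fin.Base as Fin using (Fin; zero; suc; toℕ; fromℕ<; punchOut)
open import Data.Fin.Properties as Finₚ
  using (_≟_; _<?_; any?; injective⇒≤; punchOut-injective; toℕ-injective; toℕ-fromℕ<; toℕ<n)
open import Data.List.Base as List
  using (List; []; _∷_; _++_; map; concatMap; foldr; filter; applyUpTo; length)
open import Data.List.Membership.Propositional using (_∉_; find; lose) renaming (_∈_ to _∈ˡ_)
open import Data.List.Membership.Propositional.Properties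
  using (∈-filter⁺; ∈-filter⁻; ∈-cartesianProductWith⁺; ∈-allFin; ∈-concatMap⁺; ∈-concatMap⁻;
         ∈-map⁺; ∈-map⁻; ∈-++⁺ˡ; ∈-++⁺ʳ; ∈-++⁻)
open import Data.List.Membership.Propositional.Properties.WithK using (unique∧set⇒bag)
open import Data.List.NonEmpty.Base as List⁺ using (List⁺; _∷_)
open import Data.List.Properties using (map-++; map-cong; map-cong-local; map-∘)
open import Data.List.Relation.Binary.BagAndSetEquality using (∼bag⇒↭)
open import Data.List.Relation.Binary.Disjoint.Propositional using (Disjoint)
open import Data.List.Relation.Binary.Permutation.Propositional using (_↭_)
import Data.List.Relation.Binary.Permutation.Propositional.Properties as ↭ₚ
open import Data.List.Relation.Unary.All as All using (All; []; _∷_)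
import Data.List.Relation.Unary.All.Properties as Allₚ
open import Data.List.Relation.Unary.AllPairs as AllPairs using ([]; _∷_)
import Data.List.Relation.Unary.AllPairs.Properties as AllPairsₚ
open import Data.List.Relation.Unary.Any using (here; there)
open import Data.List.Relation.Unary.Unique.Propositional using () renaming (Unique to Uniqueˡ)
import Data.List.Relation.Unary.Unique.Propositional.Properties as Uniqueₚ
open import Data.Nat.Base
open import Data.Nat.Combinatorics using (_C_; nCk+nC[k+1]≡[n+1]C[k+1]; nCn≡1; k>n⇒nCk≡0)
open import Data.Nat.ListAction using (sum)
open import Data.Nat.ListAction.Properties using (sum-++; sum-↭)
open import Data.Nat.Properties as ℕₚ hiding (_≟_; _<?_)
open import Data.Nat.Tactic.RingSolver using (solve-∀)
open import Data.Product.Base using (∃; ∃₂; _×_; _,_; proj₁; proj₂; map₂)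
open import Data.Sum.Base using (_⊎_; inj₁; inj₂)
open import Data.Unit.Base using (tt)
open import Data.Vec.Base as Vec using (Vec; []; _∷_; lookup; tail; toList)
open import Data.Vec.Membership.Propositional using (_∈_)
open import Data.Vec.Membership.Propositional.Properties using (∈-lookup; ∈-toList⁺)
open import Data.Vec.Properties using (∷-injective; toList-injective; cast-is-id)
open import Data.Vec.Relation.Unary.All as VAll using ([]; _∷_)
import Data.Vec.Relation.Unary.All.Properties as VAllₚ
open import Data.Vec.Relation.Unary.AllPairs using ([]; _∷_)
open import Data.Vec.Relation.Unary.Any as VAny using (Any; here; there)
open import Data.Vec.Relation.Unary.Any.Properties using (lookup-index)
open import Data.Vec.Relation.Unary.Unique.Propositional using (Unique)
import Data.Vec.Relation.Unary.Unique.Propositional.Properties as VUniqueₚ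
open import Function.Base using (_∘_; id)
open import Function.Bundles using (_⇔_; mk⇔; module Equivalence)
open import Relation.Binary.PropositionalEquality
open import Relation.Nullary using (¬_; Dec; yes; no; does; contradiction)
open import Relation.Unary using (Decidable)

open ≡-Reasoning

private variable
  A B : Set
  m n : ℕ

-- Finite sums

∑∈ : List A → (A → ℕ) → ℕ
∑∈ xs f = sum (map f xs)

∑∈-cong : ∀ {f g : A → ℕ} xs → (∀ x → f x ≡ g x) → ∑∈ xs f ≡ ∑∈ xs g
∑∈-cong xs f≗g = cong sum (map-cong f≗g xs)

∑∈-cong-local : ∀ {f g : A → ℕ} {xs} → All (λ x → f x ≡ g x) xs → ∑∈ xs f ≡ ∑∈ xs g
∑∈-cong-local = cong sum ∘ map-cong-local

∑∈-↭ : ∀ {xs ys : List A} (f : A → ℕ) → xs ↭ ys → ∑∈ xs f ≡ ∑∈ ys f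
∑∈-↭ f xs↭ys = sum-↭ (↭ₚ.map⁺ f xs↭ys)

∑∈-map : ∀ (f : B → ℕ) (g : A → B) xs → ∑∈ (map g xs) f ≡ ∑∈ xs (f ∘ g)
∑∈-map f g xs = cong sum (sym (map-∘ xs))

∑∈-++ : ∀ xs ys (f : A → ℕ) → ∑∈ (xs ++ ys) f ≡ ∑∈ xs f + ∑∈ ys f
∑∈-++ xs ys f = trans (cong sum (map-++ f xs ys)) (sum-++ (map f xs) (map f ys))

∑∈-concatMap : ∀ (f : B → ℕ) (g : A → List B) xs →
  ∑∈ (concatMap g xs) f ≡ ∑∈ xs (λ x → ∑∈ (g x) f)
∑∈-concatMap f g []       = refl
∑∈-concatMap f g (x ∷ xs) =
  trans (∑∈-++ (g x) (concatMap g xs) f) (cong (∑∈ (g x) f +_) (∑∈-concatMap f g xs))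

∑∈-zero : ∀ {f : A → ℕ} {xs} → All (λ x → f x ≡ 0) xs → ∑∈ xs f ≡ 0
∑∈-zero []           = refl
∑∈-zero (fx≡0 ∷ f≡0) = cong₂ _+_ fx≡0 (∑∈-zero f≡0)

+-interchange : ∀ a b c d → (a + b) + (c + d) ≡ (a + c) + (b + d)
+-interchange = solve-∀

∑∈-+ : ∀ xs (f g : A → ℕ) → ∑∈ xs (λ x → f x + g x) ≡ ∑∈ xs f + ∑∈ xs g
∑∈-+ []       f g = refl
∑∈-+ (x ∷ xs) f g =
  trans (cong (f x + g x +_) (∑∈-+ xs f g)) (+-interchange (f x) (g x) (∑∈ xs f) (∑∈ xs g))

∑< : ℕ → (ℕ → ℕ) → ℕ
∑< zero    f = 0
∑< (suc n) f = f 0 + ∑< n (f ∘ suc)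

∑<-cong : ∀ n {f g : ℕ → ℕ} → (∀ {i} → i < n → f i ≡ g i) → ∑< n f ≡ ∑< n g
∑<-cong zero    f≗g = refl
∑<-cong (suc n) f≗g = cong₂ _+_ (f≗g z<s) (∑<-cong n (f≗g ∘ s<s))

∑<-+ : ∀ n (f g : ℕ → ℕ) → ∑< n (λ i → f i + g i) ≡ ∑< n f + ∑< n g
∑<-+ zero    f g = refl
∑<-+ (suc n) f g =
  trans (cong (f 0 + g 0 +_) (∑<-+ n (f ∘ suc) (g ∘ suc))) (+-interchange (f 0) (g 0) _ _)

∑<-last : ∀ n (f : ℕ → ℕ) → ∑< (suc n) f ≡ ∑< n f + f n
∑<-last zero    f = +-comm (f 0) 0
∑<-last (suc n) f = trans (cong (f 0 +_) (∑<-last n (f ∘ suc))) (sym (+-assoc (f 0) _ _))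

∑<-zero : ∀ n {f : ℕ → ℕ} → (∀ {i} → i < n → f i ≡ 0) → ∑< n f ≡ 0
∑<-zero zero    f≡0 = refl
∑<-zero (suc n) f≡0 = cong₂ _+_ (f≡0 z<s) (∑<-zero n (f≡0 ∘ s<s))

∑<-single : ∀ {n m} {f : ℕ → ℕ} → m < n → (∀ {i} → i < n → i ≢ m → f i ≡ 0) → ∑< n f ≡ f m
∑<-single {suc n} {zero}  {f} _         off =
  trans (cong (f 0 +_) (∑<-zero n λ i<n → off (s<s i<n) λ ())) (+-identityʳ (f 0))
∑<-single {suc n} {suc m} {f} (s<s m<n) off =
  cong₂ _+_ (off z<s λ ()) (∑<-single m<n λ i<n i≢m → off (s<s i<n) (i≢m ∘ suc-injective))

∑∈-∑< : ∀ n xs (f : ℕ → A → ℕ) → ∑∈ xs (λ x → ∑< n λ i → f i x) ≡ ∑< n (λ i → ∑∈ xs (f i))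
∑∈-∑< zero    xs f = ∑∈-zero (All.universal (λ _ → refl) xs)
∑∈-∑< (suc n) xs f =
  trans (∑∈-+ xs (f 0) (λ x → ∑< n λ i → f (suc i) x))
        (cong (∑∈ xs (f 0) +_) (∑∈-∑< n xs (f ∘ suc)))

sum-applyUpTo : ∀ n (f g : ℕ → ℕ) → sum (map f (applyUpTo g n)) ≡ ∑< n (f ∘ g)
sum-applyUpTo zero    f g = refl
sum-applyUpTo (suc n) f g = cong (f (g 0) +_) (sum-applyUpTo n f (g ∘ suc))

∑⋯≡∑< : ∀ a b f → ∑[ a ⋯ b ] f ≡ ∑< (suc b ∸ a) (λ i → f (a + i))
∑⋯≡∑< a b f = sum-applyUpTo (suc b ∸ a) (λ i → f (a + i)) id

-- The common law of the two statistics and its solution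

-- The law, for a statistic valued in 0, …, N, under which one step of either
-- insertion process below changes it: inserting the new letter as a fixed
-- point keeps the number x of non-fixed points, inserting it next to one of
-- the N ∸ x fixed points raises x by 2, and otherwise x rises by 1.

step : ℕ → (ℕ → ℕ) → ℕ → ℕ
step N g x = g x + ((N ∸ x) * g (2 + x) + x * g (1 + x))

-- The last insertion is peeled off first and acts on `g`, with the length before it as the argument
-- of `step`. So `E N g` is the total of `g` over all outcomes of `N` insertions into the empty
-- word.
E : ℕ → (ℕ → ℕ) → ℕ
E zero    g = g 0
E (suc N) g = E N (step N g)

-- The derangement numbers by their two-term recurrence, the form in which they arise in `E-closed`;
-- agreement with `d` is `D≡d`.
D : ℕ → ℕ
D 0             = 1
D 1             = 0
D (suc (suc n)) = suc n * (D n + D (suc n))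

-- Both sides count subsets of size `suc k` with one marked element; the induction is by Pascal's
-- rule. It turns the factor `N ∸ k` of `step` into the factor `suc k` of the recurrence of `D`.
absorption : ∀ n k → (n ∸ k) * (n C k) ≡ suc k * (n C suc k)
absorption zero    zero    = refl
absorption zero    (suc k) = sym (*-zeroʳ (suc (suc k)))
absorption (suc n) zero    = begin
  suc n * 1                   ≡⟨ cong (λ m → suc m) (absorption n 0) ⟩
  suc (1 * (n C 1))           ≡⟨ cong suc (*-identityˡ (n C 1)) ⟩
  n C 0 + n C 1               ≡⟨ nCk+nC[k+1]≡[n+1]C[k+1] n 0 ⟩
  suc n C 1                   ≡⟨ *-identityˡ _ ⟨
  1 * (suc n C 1)             ∎
absorption (suc n) (suc k) = begin
  (n ∸ k) * (suc n C suc k)                      ≡⟨ cong ((n ∸ k) *_) (nCk+nC[k+1]≡[n+1]C[k+1] n k) ⟨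
  (n ∸ k) * (n C k + n C suc k)                  ≡⟨ *-distribˡ-+ (n ∸ k) _ _ ⟩
  (n ∸ k) * (n C k) + (n ∸ k) * (n C suc k)      ≡⟨ cong₂ _+_ (absorption n k) shifted ⟩
  suc k * (n C suc k) + (suc (suc k) * (n C suc (suc k)) + n C suc k)
    ≡⟨ rearrange k (n C suc k) (n C suc (suc k)) ⟩
  suc (suc k) * (n C suc k + n C suc (suc k))    ≡⟨ cong (suc (suc k) *_) (nCk+nC[k+1]≡[n+1]C[k+1] n (suc k)) ⟩
  suc (suc k) * (suc n C suc (suc k))            ∎
  where
  rearrange : ∀ k a b → suc k * a + (suc (suc k) * b + a) ≡ suc (suc k) * (a + b)
  rearrange = solve-∀

  -- For `k` below `n` a unit splits off from `n ∸ k`, and the induction hypothesis applies at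
  -- `suc k`; otherwise every term vanishes.
  shifted : (n ∸ k) * (n C suc k) ≡ suc (suc k) * (n C suc (suc k)) + n C suc k
  shifted with k ℕₚ.<? n
  ... | yes k<n = begin
    (n ∸ k) * (n C suc k)                          ≡⟨ cong (_* (n C suc k)) (∸-suc k<n) ⟩
    suc (n ∸ suc k) * (n C suc k)                  ≡⟨ +-comm (n C suc k) _ ⟩
    (n ∸ suc k) * (n C suc k) + n C suc k          ≡⟨ cong (_+ n C suc k) (absorption n (suc k)) ⟩
    suc (suc k) * (n C suc (suc k)) + n C suc k    ∎
    where ∸-suc : ∀ {m n} → m < n → n ∸ m ≡ suc (n ∸ suc m)
          ∸-suc {m} m<n = +-∸-assoc 1 m<n
  ... | no k≮n = begin
    (n ∸ k) * (n C suc k)                          ≡⟨ cong (_* (n C suc k)) (m≤n⇒m∸n≡0 (≮⇒≥ k≮n)) ⟩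
    0                                              ≡⟨ cong (_+ 0) (*-zeroʳ (suc (suc k))) ⟨
    suc (suc k) * 0 + 0
      ≡⟨ cong₂ (λ a b → suc (suc k) * a + b) (k>n⇒nCk≡0 (s≤s (m≤n⇒m≤1+n (≮⇒≥ k≮n)))) (k>n⇒nCk≡0 (s≤s (≮⇒≥ k≮n))) ⟨
    suc (suc k) * (n C suc (suc k)) + n C suc k    ∎

-- The coefficients obey the law of `step`: `absorption` and the recurrence of `D` merge the two
-- ways of raising the statistic to `suc k` into `(N C k) * D (suc k)`, and Pascal's rule adds the
-- outcomes that keep it.
E-closed : ∀ N g → E N g ≡ ∑< (suc N) (λ k → (N C k) * D k * g k)
E-closed zero    g = sym (trans (+-identityʳ _) (+-identityʳ (g 0)))
E-closed (suc N) g = begin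
  E N (step N g)                                   ≡⟨ E-closed N (step N g) ⟩
  ∑< (suc N) (λ k → c k * step N g k)              ≡⟨ ∑<-cong (suc N) (λ {k} _ → expand (c k) (g k) (N ∸ k) (g (2 + k)) k (g (1 + k))) ⟩
  ∑< (suc N) (λ k → c k * g k + (up₂ k + up₁ k))   ≡⟨ ∑<-+ (suc N) (λ k → c k * g k) (λ k → up₂ k + up₁ k) ⟩
  ∑< (suc N) (λ k → c k * g k) + ∑< (suc N) (λ k → up₂ k + up₁ k)
    ≡⟨ cong₂ _+_ keep (∑<-+ (suc N) up₂ up₁) ⟩
  (1 * 1 * g 0 + ∑< (suc N) kept) + (∑< (suc N) up₂ + ∑< (suc N) up₁)
    ≡⟨ cong (1 * 1 * g 0 + ∑< (suc N) kept +_) raise ⟩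
  (1 * 1 * g 0 + ∑< (suc N) kept) + ∑< (suc N) raised
    ≡⟨ +-assoc (1 * 1 * g 0) (∑< (suc N) kept) (∑< (suc N) raised) ⟩
  1 * 1 * g 0 + (∑< (suc N) kept + ∑< (suc N) raised)
    ≡⟨ cong (1 * 1 * g 0 +_) (∑<-+ (suc N) kept raised) ⟨
  1 * 1 * g 0 + ∑< (suc N) (λ k → kept k + raised k)
    ≡⟨ cong (1 * 1 * g 0 +_) (∑<-cong (suc N) λ {k} _ → pascal k) ⟩
  1 * 1 * g 0 + ∑< (suc N) (λ k → (suc N C suc k) * D (suc k) * g (suc k)) ∎
  where
  c up₂ up₁ kept raised : ℕ → ℕ
  c k      = (N C k) * D k
  kept k   = (N C suc k) * D (suc k) * g (suc k)
  raised k = (N C k) * D (suc k) * g (suc k)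
  up₂ k = c k * ((N ∸ k) * g (2 + k))
  up₁ k = c k * (k * g (1 + k))

  expand : ∀ c a x b y d → c * (a + (x * b + y * d)) ≡ c * a + (c * (x * b) + c * (y * d))
  expand = solve-∀

  -- A vanishing term at `suc N` is appended, so that the term of `g 0` can be split off.
  keep : ∑< (suc N) (λ k → c k * g k) ≡ ∑< (suc (suc N)) (λ k → c k * g k)
  keep = sym (trans (∑<-last (suc N) (λ k → c k * g k))
    (trans (cong (λ b → ∑< (suc N) (λ k → c k * g k) + b * D (suc N) * g (suc N)) (k>n⇒nCk≡0 (n<1+n N)))
           (+-identityʳ _)))

  combine : ∀ k → up₂ k + up₁ (suc k) ≡ (N C suc k) * D (2 + k) * g (2 + k)
  combine k = begin
    up₂ k + up₁ (suc k)
      ≡⟨ cong (_+ up₁ (suc k)) (swap₁ (N C k) (D k) (N ∸ k) (g (2 + k))) ⟩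
    (N ∸ k) * (N C k) * (D k * g (2 + k)) + up₁ (suc k)
      ≡⟨ cong (λ a → a * (D k * g (2 + k)) + up₁ (suc k)) (absorption N k) ⟩
    suc k * (N C suc k) * (D k * g (2 + k)) + up₁ (suc k)
      ≡⟨ swap₂ (suc k) (N C suc k) (D k) (D (suc k)) (g (2 + k)) ⟩
    (N C suc k) * D (2 + k) * g (2 + k) ∎
    where
    swap₁ : ∀ a b c d → a * b * (c * d) ≡ c * a * (b * d)
    swap₁ = solve-∀
    swap₂ : ∀ m a b c d → m * a * (b * d) + a * c * (m * d) ≡ a * (m * (b + c)) * d
    swap₂ = solve-∀

  -- `up₁` vanishes at 0 and `up₂` at `N`, which aligns the two sums after a shift; `raised` begins
  -- with a zero term because `D 1` is 0.
  raise : ∑< (suc N) up₂ + ∑< (suc N) up₁ ≡ ∑< (suc N) raised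
  raise = begin
    ∑< (suc N) up₂ + (c 0 * 0 + ∑< N (up₁ ∘ suc))
      ≡⟨ cong₂ _+_ (∑<-last N up₂) (cong (_+ ∑< N (up₁ ∘ suc)) (*-zeroʳ (c 0))) ⟩
    (∑< N up₂ + up₂ N) + ∑< N (up₁ ∘ suc)
      ≡⟨ cong (λ b → (∑< N up₂ + c N * (b * g (2 + N))) + ∑< N (up₁ ∘ suc)) (n∸n≡0 N) ⟩
    (∑< N up₂ + c N * 0) + ∑< N (up₁ ∘ suc)
      ≡⟨ cong (λ b → (∑< N up₂ + b) + ∑< N (up₁ ∘ suc)) (*-zeroʳ (c N)) ⟩
    (∑< N up₂ + 0) + ∑< N (up₁ ∘ suc)
      ≡⟨ cong (_+ ∑< N (up₁ ∘ suc)) (+-identityʳ _) ⟩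
    ∑< N up₂ + ∑< N (up₁ ∘ suc)
      ≡⟨ ∑<-+ N up₂ (up₁ ∘ suc) ⟨
    ∑< N (λ k → up₂ k + up₁ (suc k))
      ≡⟨ ∑<-cong N (λ {k} _ → combine k) ⟩
    ∑< N (λ k → (N C suc k) * D (2 + k) * g (2 + k)) ∎

  pascal : ∀ k → kept k + raised k ≡ (suc N C suc k) * D (suc k) * g (suc k)
  pascal k = begin
    kept k + raised k
      ≡⟨ factor (N C k) (N C suc k) (D (suc k)) (g (suc k)) ⟩
    (N C k + N C suc k) * D (suc k) * g (suc k)
      ≡⟨ cong (λ b → b * D (suc k) * g (suc k)) (nCk+nC[k+1]≡[n+1]C[k+1] N k) ⟩
    (suc N C suc k) * D (suc k) * g (suc k) ∎
    where
    factor : ∀ a b x y → b * x * y + a * x * y ≡ (a + b) * x * y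
    factor = solve-∀

⟦_⟧ : Bool → ℕ
⟦ b ⟧ = if b then 1 else 0

E-top : ∀ N → E N (λ k → ⟦ N ≡ᵇ k ⟧) ≡ D N
E-top N = begin
  E N top                                    ≡⟨ E-closed N top ⟩
  ∑< (suc N) (λ k → (N C k) * D k * top k)   ≡⟨ ∑<-single (n<1+n N) off ⟩
  (N C N) * D N * top N                      ≡⟨ cong₂ (λ a b → a * D N * b) (nCn≡1 N) (top≡1 N) ⟩
  1 * D N * 1                                ≡⟨ *-identityʳ (1 * D N) ⟩
  1 * D N                                    ≡⟨ *-identityˡ (D N) ⟩
  D N                                        ∎
  where
  top : ℕ → ℕ
  top k = ⟦ N ≡ᵇ k ⟧
  top≡1 : ∀ n → ⟦ n ≡ᵇ n ⟧ ≡ 1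
  top≡1 zero    = refl
  top≡1 (suc n) = top≡1 n
  ≢⇒0 : ∀ m n → n ≢ m → ⟦ m ≡ᵇ n ⟧ ≡ 0
  ≢⇒0 zero    zero    n≢m = contradiction refl n≢m
  ≢⇒0 zero    (suc n) n≢m = refl
  ≢⇒0 (suc m) zero    n≢m = refl
  ≢⇒0 (suc m) (suc n) n≢m = ≢⇒0 m n (n≢m ∘ cong suc)
  off : ∀ {k} → k < suc N → k ≢ N → (N C k) * D k * top k ≡ 0
  off {k} _ k≢N = trans (cong ((N C k) * D k *_) (≢⇒0 N k k≢N)) (*-zeroʳ ((N C k) * D k))
-- Permutations by insertion of a smallest letter

unique-words : ∀ n m → Uniqueˡ (words n m)
unique-words n zero    = [] ∷ []
unique-words n (suc m) =
  Uniqueₚ.cartesianProductWith⁺ _∷_ ∷-injective (Uniqueₚ.allFin⁺ n) (unique-words n m)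

∈-words : (v : Vec (Fin n) m) → v ∈ˡ words n m
∈-words []      = here refl
∈-words (x ∷ v) = ∈-cartesianProductWith⁺ _∷_ (∈-allFin x) (∈-words v)

unique-𝒮 : ∀ n → Uniqueˡ (𝒮 n)
unique-𝒮 n = Uniqueₚ.filter⁺ unique? (unique-words n n)

∈-𝒮⁺ : {π : Word n} → Unique π → π ∈ˡ 𝒮 n
∈-𝒮⁺ {π = π} π! = ∈-filter⁺ unique? (∈-words π) π!

∈-𝒮⁻ : {π : Word n} → π ∈ˡ 𝒮 n → Unique π
∈-𝒮⁻ {n} π∈𝒮 = proj₂ (∈-filter⁻ unique? {xs = words n n} π∈𝒮)

-- Pigeonhole: if `x` were missing, punching it out of all letters would inject `Fin (suc n)` into
-- `Fin n`.
∈-unique : {π : Word n} → Unique π → ∀ x → x ∈ π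
∈-unique {suc n} {π} π! x with any? (λ i → x ≟ lookup π i)
... | yes (i , x≡πᵢ) = subst (_∈ π) (sym x≡πᵢ) (∈-lookup i π)
... | no ∄           = contradiction (injective⇒≤ {f = λ i → punchOut (∄ ∘ (i ,_))} injective) 1+n≰n
  where
  injective : ∀ {i j} → punchOut (∄ ∘ (i ,_)) ≡ punchOut (∄ ∘ (j ,_)) → i ≡ j
  injective {i} {j} eq = VUniqueₚ.lookup-injective π! i j (punchOut-injective (∄ ∘ (i ,_)) (∄ ∘ (j ,_)) eq)

-- Two lists without repetitions and with the same members are permutations of each other. Different
-- `w` yield disjoint lists `F w` because `decode` recovers `w`.
𝒮-suc-↭ : (F : Word n → List (Word (suc n))) (decode : Word (suc n) → List (Fin n)) →
  (∀ {w v} → v ∈ˡ F w → decode v ≡ toList w) →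
  (∀ w → Uniqueˡ (F w)) →
  (∀ {w v} → Unique w → v ∈ˡ F w → Unique v) →
  (∀ {v} → Unique v → ∃ λ w → Unique w × v ∈ˡ F w) →
  𝒮 (suc n) ↭ concatMap F (𝒮 n)
𝒮-suc-↭ {n} F decode decode-F F! F-unique F-onto = ∼bag⇒↭
  (unique∧set⇒bag (unique-𝒮 (suc n))
    (Uniqueₚ.concat⁺ (Allₚ.map⁺ (All.universal F! (𝒮 n)))
                     (AllPairsₚ.map⁺ (AllPairs.map disjoint (unique-𝒮 n))))
    (mk⇔ to from))
  where
  disjoint : ∀ {w w′} → w ≢ w′ → Disjoint (F w) (F w′)
  disjoint {w} {w′} w≢w′ (v∈Fw , v∈Fw′) =
    w≢w′ (trans (sym (cast-is-id refl w)) (toList-injective refl w w′ (trans (sym (decode-F v∈Fw)) (decode-F v∈Fw′))))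

  to : ∀ {v} → v ∈ˡ 𝒮 (suc n) → v ∈ˡ concatMap F (𝒮 n)
  to v∈𝒮 with F-onto (∈-𝒮⁻ v∈𝒮)
  ... | w , w! , v∈Fw = ∈-concatMap⁺ F (lose (∈-𝒮⁺ w!) v∈Fw)

  from : ∀ {v} → v ∈ˡ concatMap F (𝒮 n) → v ∈ˡ 𝒮 (suc n)
  from v∈ with find (∈-concatMap⁻ F v∈)
  ... | w , w∈𝒮 , v∈Fw = ∈-𝒮⁺ (F-unique (∈-𝒮⁻ w∈𝒮) v∈Fw)

-- displacements lets the new letter zero take the place of a letter y, which
-- moves to the front: in the cycles of the permutation whose one-line notation
-- the word is, zero is inserted before y.

lift : Vec (Fin n) m → Vec (Fin (suc n)) m
lift = Vec.map suc

-- The insertion in front is kept apart: it is the one that preserves the statistic, and the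
-- remaining ones correspond to the letters of `v` one by one.
insertAfter : Vec (Fin n) m → List (Vec (Fin (suc n)) (suc m))
insertAfter []      = []
insertAfter (y ∷ v) = (suc y ∷ zero ∷ lift v) ∷ map (suc y ∷_) (insertAfter v)

insertions : Vec (Fin n) m → List (Vec (Fin (suc n)) (suc m))
insertions v = (zero ∷ lift v) ∷ insertAfter v

-- The head of a recursive result of `displacements` is the displaced letter, which has to stay in
-- front of `y`.
insertSecond : ∀ {A : Set} → A → Vec A (suc m) → Vec A (suc (suc m))
insertSecond y (r ∷ u) = r ∷ y ∷ u

displacements : Vec (Fin n) m → List (Vec (Fin (suc n)) (suc m))
displacements []      = []
displacements (y ∷ v) = (suc y ∷ zero ∷ lift v) ∷ map (insertSecond (suc y)) (displacements v)

cycleInsertions : Vec (Fin n) m → List (Vec (Fin (suc n)) (suc m))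
cycleInsertions v = (zero ∷ lift v) ∷ displacements v

module _ {P : Fin (suc n) → Set} (P0 : P zero) where

  insertAfter-All⁺ : ∀ {v : Vec (Fin n) m} {u} → VAll.All (P ∘ suc) v → u ∈ˡ insertAfter v → VAll.All P u
  insertAfter-All⁺ {v = y ∷ v} (p ∷ ps) (here refl) = p ∷ P0 ∷ VAllₚ.map⁺ ps
  insertAfter-All⁺ {v = y ∷ v} (p ∷ ps) (there u∈) with ∈-map⁻ (suc y ∷_) u∈
  ... | u′ , u′∈ , refl = p ∷ insertAfter-All⁺ ps u′∈

  displacements-All⁺ : ∀ {v : Vec (Fin n) m} {u} → VAll.All (P ∘ suc) v → u ∈ˡ displacements v → VAll.All P u
  displacements-All⁺ {v = y ∷ v} (p ∷ ps) (here refl) = p ∷ P0 ∷ VAllₚ.map⁺ ps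
  displacements-All⁺ {v = y ∷ v} (p ∷ ps) (there u∈) with ∈-map⁻ (insertSecond (suc y)) u∈
  ... | r ∷ u′ , u′∈ , refl with displacements-All⁺ ps u′∈
  ...   | q ∷ qs = q ∷ p ∷ qs

module _ {P : Fin (suc n) → Set} where

  insertAfter-All⁻ : ∀ {v : Vec (Fin n) m} {u} → u ∈ˡ insertAfter v → VAll.All P u → VAll.All (P ∘ suc) v
  insertAfter-All⁻ {v = y ∷ v} (here refl) (p ∷ _ ∷ ps) = p ∷ VAllₚ.map⁻ ps
  insertAfter-All⁻ {v = y ∷ v} (there u∈) ps with ∈-map⁻ (suc y ∷_) u∈ | ps
  ... | u′ , u′∈ , refl | p ∷ ps′ = p ∷ insertAfter-All⁻ u′∈ ps′

  insertions-All⁻ : ∀ {v : Vec (Fin n) m} {u} → u ∈ˡ insertions v → VAll.All P u → VAll.All (P ∘ suc) v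
  insertions-All⁻ (here refl) (_ ∷ ps) = VAllₚ.map⁻ ps
  insertions-All⁻ (there u∈)  ps       = insertAfter-All⁻ u∈ ps

  displacements-All⁻ : ∀ {v : Vec (Fin n) m} {u} → u ∈ˡ displacements v → VAll.All P u → VAll.All (P ∘ suc) v
  displacements-All⁻ {v = y ∷ v} (here refl) (p ∷ _ ∷ ps) = p ∷ VAllₚ.map⁻ ps
  displacements-All⁻ {v = y ∷ v} (there u∈) ps with ∈-map⁻ (insertSecond (suc y)) u∈
  displacements-All⁻ {v = y ∷ v} (there u∈) (q ∷ p ∷ ps) | r ∷ u′ , u′∈ , refl =
    p ∷ displacements-All⁻ u′∈ (q ∷ ps)

lift-fresh : (v : Vec (Fin n) m) → VAll.All (zero ≢_) (lift v)
lift-fresh v = VAllₚ.map⁺ (VAll.universal (λ _ ()) v)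

lift-unique : {v : Vec (Fin n) m} → Unique v → Unique (lift v)
lift-unique = VUniqueₚ.map⁺ Finₚ.suc-injective

lift-unique⁻ : {v : Vec (Fin n) m} → Unique (lift v) → Unique v
lift-unique⁻ {v = []}    []         = []
lift-unique⁻ {v = _ ∷ _} (x∉v ∷ v!) = VAll.map (_∘ cong suc) (VAllₚ.map⁻ x∉v) ∷ lift-unique⁻ v!

suc-≢ : ∀ {y} {v : Vec (Fin n) m} → VAll.All (y ≢_) v → VAll.All ((suc y ≢_) ∘ suc) v
suc-≢ = VAll.map (_∘ Finₚ.suc-injective)

insertAfter-unique : {v : Vec (Fin n) m} {u : Vec (Fin (suc n)) (suc m)} → Unique v → u ∈ˡ insertAfter v → Unique u
insertAfter-unique {v = y ∷ v} (y∉v ∷ v!) (here refl) =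
  ((λ ()) ∷ VAllₚ.map⁺ (suc-≢ y∉v)) ∷ lift-fresh v ∷ lift-unique v!
insertAfter-unique {v = y ∷ v} (y∉v ∷ v!) (there u∈) with ∈-map⁻ (suc y ∷_) u∈
... | u′ , u′∈ , refl = insertAfter-All⁺ (λ ()) (suc-≢ y∉v) u′∈ ∷ insertAfter-unique v! u′∈

insertions-unique : {v : Vec (Fin n) m} {u : Vec (Fin (suc n)) (suc m)} → Unique v → u ∈ˡ insertions v → Unique u
insertions-unique {v = v} v! (here refl) = lift-fresh v ∷ lift-unique v!
insertions-unique v! (there u∈)          = insertAfter-unique v! u∈

displacements-unique : {v : Vec (Fin n) m} {u : Vec (Fin (suc n)) (suc m)} → Unique v → u ∈ˡ displacements v → Unique u
displacements-unique {v = y ∷ v} (y∉v ∷ v!) (here refl) =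
  ((λ ()) ∷ VAllₚ.map⁺ (suc-≢ y∉v)) ∷ lift-fresh v ∷ lift-unique v!
displacements-unique {v = y ∷ v} (y∉v ∷ v!) (there u∈) with ∈-map⁻ (insertSecond (suc y)) u∈
... | r ∷ u′ , u′∈ , refl with displacements-unique v! u′∈ | displacements-All⁺ (λ ()) (suc-≢ y∉v) u′∈
...   | r∉u′ ∷ u′! | y≢r ∷ y∉u′ = (y≢r ∘ sym ∷ r∉u′) ∷ y∉u′ ∷ u′!

cycleInsertions-unique : {v : Vec (Fin n) m} {u : Vec (Fin (suc n)) (suc m)} → Unique v → u ∈ˡ cycleInsertions v → Unique u
cycleInsertions-unique {v = v} v! (here refl) = lift-fresh v ∷ lift-unique v!
cycleInsertions-unique v! (there u∈)          = displacements-unique v! u∈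

lower-fresh : (u : Vec (Fin (suc n)) m) → VAll.All (zero ≢_) u → ∃ λ v → u ≡ lift v
lower-fresh []          []         = [] , refl
lower-fresh (zero ∷ u)  (0≢0 ∷ _)  = contradiction refl 0≢0
lower-fresh (suc x ∷ u) (_ ∷ 0∉u) with lower-fresh u 0∉u
... | v , refl = x ∷ v , refl

insertions-onto : {u : Vec (Fin (suc n)) (suc m)} → Unique u → zero ∈ u → ∃ λ v → Unique v × u ∈ˡ insertions v
insertions-onto {u = zero ∷ u} (0∉u ∷ u!) _ with lower-fresh u 0∉u
... | v , refl = v , lift-unique⁻ u! , here refl
insertions-onto {m = suc m} {u = suc y ∷ u} (y∉u ∷ u!) (there 0∈u) with insertions-onto u! 0∈u
... | v , v! , u∈ = y ∷ v , VAll.map (_∘ cong suc) (insertions-All⁻ u∈ y∉u) ∷ v! , there (extend u∈)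
  where
  -- Inserting in front of the tail means inserting right after `y`.
  extend : u ∈ˡ insertions v → (suc y ∷ u) ∈ˡ insertAfter (y ∷ v)
  extend (here refl) = here refl
  extend (there u∈)  = there (∈-map⁺ (suc y ∷_) u∈)

-- The displaced letter `r` is carried along as the head until the zero is reached, whose place it
-- then takes.
displacements-onto : ∀ {r} {u : Vec (Fin (suc n)) m} → Unique (suc r ∷ u) → zero ∈ u →
                     ∃ λ v → Unique v × (suc r ∷ u) ∈ˡ displacements v
displacements-onto {r = r} {u = zero ∷ u} ((_ ∷ r∉u) ∷ 0∉u ∷ u!) _ with lower-fresh u 0∉u
... | v , refl = r ∷ v , VAll.map (_∘ cong suc) (VAllₚ.map⁻ r∉u) ∷ lift-unique⁻ u! , here refl
displacements-onto {r = r} {u = suc y ∷ u} ((r≢y ∷ r∉u) ∷ y∉u ∷ u!) (there 0∈u)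
  with displacements-onto (r∉u ∷ u!) 0∈u
... | v , v! , u∈ =
  y ∷ v , VAll.map (_∘ cong suc) (displacements-All⁻ u∈ (r≢y ∘ sym ∷ y∉u)) ∷ v! , there (∈-map⁺ (insertSecond (suc y)) u∈)

cycleInsertions-onto : {u : Vec (Fin (suc n)) (suc m)} → Unique u → zero ∈ u → ∃ λ v → Unique v × u ∈ˡ cycleInsertions v
cycleInsertions-onto {u = zero ∷ u} (0∉u ∷ u!) _ with lower-fresh u 0∉u
... | v , refl = v , lift-unique⁻ u! , here refl
cycleInsertions-onto {u = suc r ∷ u} u! (there 0∈u) = map₂ (map₂ there) (displacements-onto u! 0∈u)

lower : Vec (Fin (suc n)) m → List (Fin n)
lower []          = []
lower (zero ∷ u)  = lower u
lower (suc x ∷ u) = x ∷ lower u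

lower-lift : (v : Vec (Fin n) m) → lower (lift v) ≡ toList v
lower-lift []      = refl
lower-lift (x ∷ v) = cong (x ∷_) (lower-lift v)

lower-insertAfter : {v : Vec (Fin n) m} {u : Vec (Fin (suc n)) (suc m)} → u ∈ˡ insertAfter v → lower u ≡ toList v
lower-insertAfter {v = y ∷ v} (here refl) = cong (y ∷_) (lower-lift v)
lower-insertAfter {v = y ∷ v} (there u∈) with ∈-map⁻ (suc y ∷_) u∈
... | u′ , u′∈ , refl = cong (y ∷_) (lower-insertAfter u′∈)

lower-insertions : {v : Vec (Fin n) m} {u : Vec (Fin (suc n)) (suc m)} → u ∈ˡ insertions v → lower u ≡ toList v
lower-insertions {v = v} (here refl) = lower-lift v
lower-insertions (there u∈)          = lower-insertAfter u∈

fill : Fin (suc n) → Fin (suc n) → Fin (suc n)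
fill r zero    = r
fill r (suc x) = suc x

-- Undoes `cycleInsertions`: the front letter returns to the place of zero. If zero itself is in
-- front, the rest contains no zero, and the same formula serves.
lowerCycle : Vec (Fin (suc n)) (suc m) → List (Fin n)
lowerCycle (r ∷ u) = lower (Vec.map (fill r) u)

lower-fill-lift : ∀ r (v : Vec (Fin n) m) → lower (Vec.map (fill r) (lift v)) ≡ toList v
lower-fill-lift r []      = refl
lower-fill-lift r (x ∷ v) = cong (x ∷_) (lower-fill-lift r v)

lower-displacements : {v : Vec (Fin n) m} {u : Vec (Fin (suc n)) (suc m)} → u ∈ˡ displacements v → lowerCycle u ≡ toList v
lower-displacements {v = y ∷ v} (here refl) = cong (y ∷_) (lower-fill-lift (suc y) v)
lower-displacements {v = y ∷ v} (there u∈) with ∈-map⁻ (insertSecond (suc y)) u∈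
... | r ∷ u′ , u′∈ , refl = cong (y ∷_) (lower-displacements u′∈)

lower-cycleInsertions : {v : Vec (Fin n) m} {u : Vec (Fin (suc n)) (suc m)} → u ∈ˡ cycleInsertions v → lowerCycle u ≡ toList v
lower-cycleInsertions {v = v} (here refl) = lower-fill-lift zero v
lower-cycleInsertions (there u∈)          = lower-displacements u∈

insertSecond-injective : ∀ {A : Set} {y : A} {u u′ : Vec A (suc m)} →
                         insertSecond y u ≡ insertSecond y u′ → u ≡ u′
insertSecond-injective {u = _ ∷ _} {u′ = _ ∷ _} refl = refl

zero∷∉insertAfter : {v : Vec (Fin n) m} {u : Vec (Fin (suc n)) m} → ¬ ((zero ∷ u) ∈ˡ insertAfter v)
zero∷∉insertAfter {v = y ∷ v} (there u∈) with ∈-map⁻ (suc y ∷_) u∈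
... | _ , _ , ()

zero∷∉displacements : {v : Vec (Fin n) m} {u : Vec (Fin (suc n)) m} → ¬ ((zero ∷ u) ∈ˡ displacements v)
zero∷∉displacements {v = y ∷ v} (there u∈) with ∈-map⁻ (insertSecond (suc y)) u∈
... | _ ∷ _ , u′∈ , refl = zero∷∉displacements u′∈

unique-insertAfter : (v : Vec (Fin n) m) → Uniqueˡ (insertAfter v)
unique-insertAfter []      = []
unique-insertAfter (y ∷ v) =
  Allₚ.map⁺ (All.tabulate λ { u∈ refl → zero∷∉insertAfter u∈ }) ∷
  Uniqueₚ.map⁺ (proj₂ ∘ ∷-injective) (unique-insertAfter v)

unique-insertions : (v : Vec (Fin n) m) → Uniqueˡ (insertions v)
unique-insertions v = All.tabulate (λ { u∈ refl → zero∷∉insertAfter u∈ }) ∷ unique-insertAfter v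

unique-displacements : (v : Vec (Fin n) m) → Uniqueˡ (displacements v)
unique-displacements []      = []
unique-displacements (y ∷ v) =
  Allₚ.map⁺ (All.universal (λ { (_ ∷ _) () }) (displacements v)) ∷
  Uniqueₚ.map⁺ insertSecond-injective (unique-displacements v)

unique-cycleInsertions : (v : Vec (Fin n) m) → Uniqueˡ (cycleInsertions v)
unique-cycleInsertions v = All.tabulate (λ { u∈ refl → zero∷∉displacements u∈ }) ∷ unique-displacements v

𝒮-↭-insertions : ∀ n → 𝒮 (suc n) ↭ concatMap insertions (𝒮 n)
𝒮-↭-insertions n = 𝒮-suc-↭ insertions lower lower-insertions unique-insertions insertions-unique
  (λ v! → insertions-onto v! (∈-unique v! zero))

𝒮-↭-cycleInsertions : ∀ n → 𝒮 (suc n) ↭ concatMap cycleInsertions (𝒮 n)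
𝒮-↭-cycleInsertions n = 𝒮-suc-↭ cycleInsertions lowerCycle lower-cycleInsertions unique-cycleInsertions
  cycleInsertions-unique (λ v! → cycleInsertions-onto v! (∈-unique v! zero))

∑𝒮-insertions : ∀ n (f : Word (suc n) → ℕ) → ∑∈ (𝒮 (suc n)) f ≡ ∑∈ (𝒮 n) (λ w → ∑∈ (insertions w) f)
∑𝒮-insertions n f = trans (∑∈-↭ f (𝒮-↭-insertions n)) (∑∈-concatMap f insertions (𝒮 n))

∑𝒮-cycleInsertions : ∀ n (f : Word (suc n) → ℕ) → ∑∈ (𝒮 (suc n)) f ≡ ∑∈ (𝒮 n) (λ w → ∑∈ (cycleInsertions w) f)
∑𝒮-cycleInsertions n f = trans (∑∈-↭ f (𝒮-↭-cycleInsertions n)) (∑∈-concatMap f cycleInsertions (𝒮 n))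

-- Numbers of fixed points

-- A set flag will mark a fixed point or an isolated letter; the statistic counts the others.
unflagged : Vec Bool m → ℕ
unflagged []          = 0
unflagged (true  ∷ b) = unflagged b
unflagged (false ∷ b) = suc (unflagged b)

unflagged≤ : (b : Vec Bool m) → unflagged b ≤ m
unflagged≤ []          = z≤n
unflagged≤ (true  ∷ b) = m≤n⇒m≤1+n (unflagged≤ b)
unflagged≤ (false ∷ b) = s≤s (unflagged≤ b)

-- One vector for each position, whether or not its flag was set: this is how both insertion
-- processes act on the flags.
clearings : Vec Bool m → List (Vec Bool m)
clearings []      = []
clearings (a ∷ b) = (false ∷ b) ∷ map (a ∷_) (clearings b)

-- Clearing a set flag raises the count by one, clearing any other changes nothing. At `g ∘ suc`
-- this is the second summand of `step`.
∑-clearings : ∀ (g : ℕ → ℕ) (b : Vec Bool m) →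
  ∑∈ (clearings b) (g ∘ unflagged) ≡ (m ∸ unflagged b) * g (suc (unflagged b)) + unflagged b * g (unflagged b)
∑-clearings         g []          = refl
∑-clearings {suc m} g (true  ∷ b) = begin
  g (suc x) + ∑∈ (map (true ∷_) (clearings b)) (g ∘ unflagged)
    ≡⟨ cong (g (suc x) +_) (∑∈-map (g ∘ unflagged) (true ∷_) (clearings b)) ⟩
  g (suc x) + ∑∈ (clearings b) (g ∘ unflagged)            ≡⟨ cong (g (suc x) +_) (∑-clearings g b) ⟩
  g (suc x) + ((m ∸ x) * g (suc x) + x * g x)             ≡⟨ +-assoc (g (suc x)) _ _ ⟨
  suc (m ∸ x) * g (suc x) + x * g x                       ≡⟨ cong (λ k → k * g (suc x) + x * g x) (∸-suc (unflagged≤ b)) ⟨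
  (suc m ∸ x) * g (suc x) + x * g x                       ∎
  where
  x = unflagged b
  ∸-suc : x ≤ m → suc m ∸ x ≡ suc (m ∸ x)
  ∸-suc = +-∸-assoc 1
∑-clearings {suc m} g (false ∷ b) = begin
  g (suc x) + ∑∈ (map (false ∷_) (clearings b)) (g ∘ unflagged)
    ≡⟨ cong (g (suc x) +_) (∑∈-map (g ∘ unflagged) (false ∷_) (clearings b)) ⟩
  g (suc x) + ∑∈ (clearings b) (g ∘ suc ∘ unflagged)      ≡⟨ cong (g (suc x) +_) (∑-clearings (g ∘ suc) b) ⟩
  g (suc x) + ((m ∸ x) * g (2 + x) + x * g (suc x))       ≡⟨ rearrange (g (suc x)) ((m ∸ x) * g (2 + x)) (x * g (suc x)) ⟩
  (m ∸ x) * g (2 + x) + suc x * g (suc x)                 ∎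
  where
  x = unflagged b
  rearrange : ∀ a b c → a + (b + c) ≡ b + (a + c)
  rearrange = solve-∀

fixes : ℕ → Vec (Fin n) m → Vec Bool m
fixes k []      = []
fixes k (x ∷ v) = (toℕ x ≡ᵇ k) ∷ fixes (suc k) v

fixes-lift : ∀ k (v : Vec (Fin n) m) → fixes (suc k) (lift v) ≡ fixes k v
fixes-lift k []      = refl
fixes-lift k (x ∷ v) = cong (_ ∷_) (fixes-lift (suc k) v)

-- Letters that stay behind the front move up by one in position and in value, so their flags
-- persist; the place of the displaced letter receives zero, which is not fixed there.
fixes-displacements : ∀ k (v : Vec (Fin n) m) →
  map (fixes (suc k) ∘ tail) (displacements v) ≡ clearings (fixes k v)
fixes-displacements k []      = refl
fixes-displacements k (y ∷ v) = cong₂ _∷_ (cong (false ∷_) (fixes-lift (suc k) v)) (begin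
  map (fixes (suc k) ∘ tail) (map (insertSecond (suc y)) (displacements v))  ≡⟨ map-∘ (displacements v) ⟨
  map (fixes (suc k) ∘ tail ∘ insertSecond (suc y)) (displacements v)
    ≡⟨ map-cong (λ { (r ∷ u) → refl }) (displacements v) ⟩
  map (((toℕ y ≡ᵇ k) ∷_) ∘ fixes (2 + k) ∘ tail) (displacements v)           ≡⟨ map-∘ (displacements v) ⟩
  map ((toℕ y ≡ᵇ k) ∷_) (map (fixes (2 + k) ∘ tail) (displacements v))
    ≡⟨ cong (map ((toℕ y ≡ᵇ k) ∷_)) (fixes-displacements (suc k) v) ⟩
  map ((toℕ y ≡ᵇ k) ∷_) (clearings (fixes (suc k) v))                        ∎)

-- A zero in front is a new fixed point. A displaced letter in front is not fixed and accounts for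
-- the additional `suc`.
∑-fixes-cycleInsertions : ∀ (g : ℕ → ℕ) (v : Vec (Fin n) m) →
  ∑∈ (cycleInsertions v) (g ∘ unflagged ∘ fixes 0) ≡ step m g (unflagged (fixes 0 v))
∑-fixes-cycleInsertions g v = cong₂ _+_ (cong (g ∘ unflagged) (fixes-lift 0 v)) (begin
  ∑∈ (displacements v) (g ∘ unflagged ∘ fixes 0)
    ≡⟨ ∑∈-cong-local (All.tabulate (displaced v)) ⟩
  ∑∈ (displacements v) (g ∘ suc ∘ unflagged ∘ fixes 1 ∘ tail)
    ≡⟨ ∑∈-map (g ∘ suc ∘ unflagged) (fixes 1 ∘ tail) (displacements v) ⟨
  ∑∈ (map (fixes 1 ∘ tail) (displacements v)) (g ∘ suc ∘ unflagged)
    ≡⟨ cong (λ bs → ∑∈ bs (g ∘ suc ∘ unflagged)) (fixes-displacements 0 v) ⟩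
  ∑∈ (clearings (fixes 0 v)) (g ∘ suc ∘ unflagged)
    ≡⟨ ∑-clearings (g ∘ suc) (fixes 0 v) ⟩
  _ ∎)
  where
  displaced : ∀ (v : Vec (Fin n) m) {u} → u ∈ˡ displacements v →
              g (unflagged (fixes 0 u)) ≡ g (suc (unflagged (fixes 1 (tail u))))
  displaced v {zero ∷ u}  u∈ with () ← zero∷∉displacements u∈
  displaced v {suc r ∷ u} u∈ = refl

-- Numbers of isolated letters

-- Here and below the bound k is one more than the largest letter to the left,
-- and 0 if there is none; so k <ᵇ suc (toℕ x) says that x is a left-to-right
-- maximum.

opens : ℕ → Vec (Fin n) m → Bool
opens k []      = true
opens k (x ∷ v) = k <ᵇ suc (toℕ x)

isolated : ℕ → Fin n → Vec (Fin n) m → Bool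
isolated k x v = (k <ᵇ suc (toℕ x)) ∧ opens (k ⊔ suc (toℕ x)) v

isolations : ℕ → Vec (Fin n) m → Vec Bool m
isolations k []      = []
isolations k (x ∷ v) = isolated k x v ∷ isolations (k ⊔ suc (toℕ x)) v

opens-lift : ∀ k (v : Vec (Fin n) m) → opens (suc k) (lift v) ≡ opens k v
opens-lift k []      = refl
opens-lift k (x ∷ v) = refl

opens-1-lift : (v : Vec (Fin n) m) → opens 1 (lift v) ≡ true
opens-1-lift []      = refl
opens-1-lift (x ∷ v) = refl

opens-insertAfter : ∀ k {v : Vec (Fin n) m} {u} → u ∈ˡ insertAfter v → opens (suc k) u ≡ opens k v
opens-insertAfter k {y ∷ v} (here refl) = refl
opens-insertAfter k {y ∷ v} (there u∈) with ∈-map⁻ (suc y ∷_) u∈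
... | _ , _ , refl = refl

isolated-lift : ∀ k (y : Fin n) (v : Vec (Fin n) m) → isolated (suc k) (suc y) (lift v) ≡ isolated k y v
isolated-lift k y v = cong ((k <ᵇ suc (toℕ y)) ∧_) (opens-lift _ v)

isolated-insertAfter : ∀ k (y : Fin n) {v : Vec (Fin n) m} {u} → u ∈ˡ insertAfter v →
                       isolated (suc k) (suc y) u ≡ isolated k y v
isolated-insertAfter k y u∈ = cong ((k <ᵇ suc (toℕ y)) ∧_) (opens-insertAfter _ u∈)

isolations-lift : ∀ k (v : Vec (Fin n) m) → isolations (suc k) (lift v) ≡ isolations k v
isolations-lift k []      = refl
isolations-lift k (x ∷ v) = cong₂ _∷_ (isolated-lift k x v) (isolations-lift _ v)

-- A zero right after `y` is no left-to-right maximum, so neither it nor `y` is isolated, and all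
-- other flags stay. Only counts are compared, as the place of the new flag varies.
unflagged-insertAfter : ∀ k (v : Vec (Fin n) m) →
  map (unflagged ∘ isolations (suc k)) (insertAfter v) ≡ map (suc ∘ unflagged) (clearings (isolations k v))
unflagged-insertAfter k []      = refl
unflagged-insertAfter k (y ∷ v) = cong₂ _∷_ first (begin
  map (unflagged ∘ isolations (suc k)) (map (suc y ∷_) (insertAfter v))
    ≡⟨ map-∘ (insertAfter v) ⟨
  map (λ u → unflagged (isolated (suc k) (suc y) u ∷ isolations (suc k′) u)) (insertAfter v)
    ≡⟨ map-cong-local (All.tabulate λ {u} u∈ →
         trans (cong (λ a → unflagged (a ∷ isolations (suc k′) u)) (isolated-insertAfter k y u∈))
               (unflagged-∷ iso (isolations (suc k′) u))) ⟩
  map (prepend iso ∘ unflagged ∘ isolations (suc k′)) (insertAfter v)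
    ≡⟨ map-∘ (insertAfter v) ⟩
  map (prepend iso) (map (unflagged ∘ isolations (suc k′)) (insertAfter v))
    ≡⟨ cong (map (prepend iso)) (unflagged-insertAfter k′ v) ⟩
  map (prepend iso) (map (suc ∘ unflagged) (clearings (isolations k′ v)))
    ≡⟨ map-∘ (clearings (isolations k′ v)) ⟨
  map (prepend iso ∘ suc ∘ unflagged) (clearings (isolations k′ v))
    ≡⟨ map-cong (λ b → trans (prepend-suc iso _) (cong suc (sym (unflagged-∷ iso b)))) (clearings (isolations k′ v)) ⟩
  map (suc ∘ unflagged ∘ (iso ∷_)) (clearings (isolations k′ v))
    ≡⟨ map-∘ (clearings (isolations k′ v)) ⟩
  map (suc ∘ unflagged) (map (iso ∷_) (clearings (isolations k′ v))) ∎)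
  where
  k′ : ℕ
  k′ = k ⊔ suc (toℕ y)
  iso : Bool
  iso = isolated k y v
  prepend : Bool → ℕ → ℕ
  prepend a x = if a then x else suc x
  unflagged-∷ : ∀ a {m} (b : Vec Bool m) → unflagged (a ∷ b) ≡ prepend a (unflagged b)
  unflagged-∷ true  b = refl
  unflagged-∷ false b = refl
  prepend-suc : ∀ a x → prepend a (suc x) ≡ suc (prepend a x)
  prepend-suc true  x = refl
  prepend-suc false x = refl
  first : unflagged (isolations (suc k) (suc y ∷ zero ∷ lift v)) ≡ suc (suc (unflagged (isolations k′ v)))
  first rewrite ∧-zeroʳ (k <ᵇ suc (toℕ y)) | ⊔-identityʳ k′ | isolations-lift k′ v = refl

-- These words begin with a positive letter, for which the bounds 0 and 1 are equivalent.
isolations-insertAfter-0 : (v : Vec (Fin n) m) {u : Vec (Fin (suc n)) (suc m)} → u ∈ˡ insertAfter v →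
                           isolations 0 u ≡ isolations 1 u
isolations-insertAfter-0 v {zero ∷ u}  u∈ with () ← zero∷∉insertAfter u∈
isolations-insertAfter-0 v {suc y ∷ u} u∈ = refl

-- A zero in front is followed by a larger letter or by none, so it is isolated, and it leaves the
-- other flags alone.
∑-isolations-insertions : ∀ (g : ℕ → ℕ) (v : Vec (Fin n) m) →
  ∑∈ (insertions v) (g ∘ unflagged ∘ isolations 0) ≡ step m g (unflagged (isolations 0 v))
∑-isolations-insertions g v = cong₂ _+_ front (begin
  ∑∈ (insertAfter v) (g ∘ unflagged ∘ isolations 0)
    ≡⟨ ∑∈-cong-local (All.tabulate λ u∈ → cong (g ∘ unflagged) (isolations-insertAfter-0 v u∈)) ⟩
  ∑∈ (insertAfter v) (g ∘ unflagged ∘ isolations 1)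
    ≡⟨ ∑∈-map g (unflagged ∘ isolations 1) (insertAfter v) ⟨
  ∑∈ (map (unflagged ∘ isolations 1) (insertAfter v)) g
    ≡⟨ cong (λ xs → ∑∈ xs g) (unflagged-insertAfter 0 v) ⟩
  ∑∈ (map (suc ∘ unflagged) (clearings (isolations 0 v))) g
    ≡⟨ ∑∈-map g (suc ∘ unflagged) (clearings (isolations 0 v)) ⟩
  ∑∈ (clearings (isolations 0 v)) (g ∘ suc ∘ unflagged)
    ≡⟨ ∑-clearings (g ∘ suc) (isolations 0 v) ⟩
  _ ∎)
  where
  front : g (unflagged (isolations 0 (zero ∷ lift v))) ≡ g (unflagged (isolations 0 v))
  front rewrite opens-1-lift v | isolations-lift 0 v = refl

∑𝒮-fixes : ∀ N g → ∑∈ (𝒮 N) (g ∘ unflagged ∘ fixes 0) ≡ E N g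
∑𝒮-fixes zero    g = +-identityʳ (g 0)
∑𝒮-fixes (suc N) g = begin
  ∑∈ (𝒮 (suc N)) (g ∘ unflagged ∘ fixes 0)
    ≡⟨ ∑𝒮-cycleInsertions N (g ∘ unflagged ∘ fixes 0) ⟩
  ∑∈ (𝒮 N) (λ w → ∑∈ (cycleInsertions w) (g ∘ unflagged ∘ fixes 0))
    ≡⟨ ∑∈-cong (𝒮 N) (∑-fixes-cycleInsertions g) ⟩
  ∑∈ (𝒮 N) (step N g ∘ unflagged ∘ fixes 0)
    ≡⟨ ∑𝒮-fixes N (step N g) ⟩
  E N (step N g) ∎

-- The same law and the same start as in `∑𝒮-fixes`, whence the equidistribution.
∑𝒮-isolations : ∀ N g → ∑∈ (𝒮 N) (g ∘ unflagged ∘ isolations 0) ≡ E N g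
∑𝒮-isolations zero    g = +-identityʳ (g 0)
∑𝒮-isolations (suc N) g = begin
  ∑∈ (𝒮 (suc N)) (g ∘ unflagged ∘ isolations 0)
    ≡⟨ ∑𝒮-insertions N (g ∘ unflagged ∘ isolations 0) ⟩
  ∑∈ (𝒮 N) (λ w → ∑∈ (insertions w) (g ∘ unflagged ∘ isolations 0))
    ≡⟨ ∑∈-cong (𝒮 N) (∑-isolations-insertions g) ⟩
  ∑∈ (𝒮 N) (step N g ∘ unflagged ∘ isolations 0)
    ≡⟨ ∑𝒮-isolations N (step N g) ⟩
  E N (step N g) ∎

-- The letters of a word relative to a chosen letter s: a larger letter or s
-- itself carries the information whether it is isolated, and a smaller letter
-- whether no letter strictly between it and s comes later.

data Mark : Set where
  smaller chosen larger : Bool → Mark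

mark : (x<s s<x isolated descends : Bool) → Mark
mark true  _     _ d = smaller d
mark false false i _ = chosen i
mark false true  i _ = larger i

descends : ℕ → ℕ → Vec (Fin n) m → Bool
descends s x []      = true
descends s x (y ∷ v) = not ((x <ᵇ toℕ y) ∧ (toℕ y <ᵇ s)) ∧ descends s x v

marks : ℕ → ℕ → Vec (Fin n) m → Vec Mark m
marks s k []      = []
marks s k (x ∷ v) =
  mark (toℕ x <ᵇ s) (s <ᵇ toℕ x) (isolated k x v) (descends s (toℕ x) v) ∷ marks s (k ⊔ suc (toℕ x)) v

noSmaller : Vec Mark m → Bool
noSmaller []              = true
noSmaller (smaller _ ∷ L) = false
noSmaller (chosen _  ∷ L) = noSmaller L
noSmaller (larger _  ∷ L) = noSmaller L

unisolate : Mark → Mark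
unisolate (smaller d) = smaller d
unisolate (chosen _)  = chosen false
unisolate (larger _)  = larger false

-- Mirrors `insertAfter`. Every older letter exceeds the new one, so the new flag is `noSmaller` of
-- what follows, while older flags of smaller letters are not affected.
markInsertAfter : Vec Mark m → List (Vec Mark (suc m))
markInsertAfter []      = []
markInsertAfter (a ∷ L) = (unisolate a ∷ smaller (noSmaller L) ∷ L) ∷ map (a ∷_) (markInsertAfter L)

descends-lift : ∀ s x (v : Vec (Fin n) m) → descends (suc s) (suc x) (lift v) ≡ descends s x v
descends-lift s x []      = refl
descends-lift s x (y ∷ v) = cong (_ ∧_) (descends-lift s x v)

descends-insertAfter : ∀ s x {v : Vec (Fin n) m} {u} → u ∈ˡ insertAfter v →
                       descends (suc s) (suc x) u ≡ descends s x v
descends-insertAfter s x {y ∷ v} (here refl) = cong (_ ∧_) (descends-lift s x v)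
descends-insertAfter s x {y ∷ v} (there u∈) with ∈-map⁻ (suc y ∷_) u∈
... | u′ , u′∈ , refl = cong (_ ∧_) (descends-insertAfter s x u′∈)

descends-0 : ∀ s k (v : Vec (Fin n) m) → descends (suc s) 0 (lift v) ≡ noSmaller (marks s k v)
descends-0 s k []      = refl
descends-0 s k (y ∷ v) with toℕ y <ᵇ s | s <ᵇ toℕ y
... | true  | _     = refl
... | false | true  = descends-0 s _ v
... | false | false = descends-0 s _ v

marks-lift : ∀ s k (v : Vec (Fin n) m) → marks (suc s) (suc k) (lift v) ≡ marks s k v
marks-lift s k []      = refl
marks-lift s k (x ∷ v) = cong₂ _∷_
  (cong₂ (mark (toℕ x <ᵇ s) (s <ᵇ toℕ x)) (isolated-lift k x v) (descends-lift s (toℕ x) v))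
  (marks-lift s _ v)

marks-insertAfter : ∀ s k (v : Vec (Fin n) m) →
  map (marks (suc s) (suc k)) (insertAfter v) ≡ markInsertAfter (marks s k v)
marks-insertAfter s k []      = refl
marks-insertAfter s k (y ∷ v) = cong₂ _∷_ (cong₂ _∷_ head≡ (cong₂ _∷_ (cong smaller (descends-0 s k′ v)) rest≡)) (begin
  map (marks (suc s) (suc k)) (map (suc y ∷_) (insertAfter v))
    ≡⟨ map-∘ (insertAfter v) ⟨
  map (marks (suc s) (suc k) ∘ (suc y ∷_)) (insertAfter v)
    ≡⟨ map-cong-local (All.tabulate λ {u} u∈ → cong (_∷ marks (suc s) (suc k′) u) (cong₂ (mark (toℕ y <ᵇ s) (s <ᵇ toℕ y))
         (isolated-insertAfter k y u∈) (descends-insertAfter s (toℕ y) u∈))) ⟩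
  map ((a ∷_) ∘ marks (suc s) (suc k′)) (insertAfter v)
    ≡⟨ map-∘ (insertAfter v) ⟩
  map (a ∷_) (map (marks (suc s) (suc k′)) (insertAfter v))
    ≡⟨ cong (map (a ∷_)) (marks-insertAfter s k′ v) ⟩
  map (a ∷_) (markInsertAfter (marks s k′ v)) ∎)
  where
  k′ : ℕ
  k′ = k ⊔ suc (toℕ y)
  a : Mark
  a = mark (toℕ y <ᵇ s) (s <ᵇ toℕ y) (isolated k y v) (descends s (toℕ y) v)
  unisolate-mark : ∀ b c {i d} → mark b c false d ≡ unisolate (mark b c i d)
  unisolate-mark true  _     = refl
  unisolate-mark false true  = refl
  unisolate-mark false false = refl
  head≡ : mark (toℕ y <ᵇ s) (s <ᵇ toℕ y) (isolated (suc k) (suc y) (zero ∷ lift v)) (descends (suc s) (suc (toℕ y)) (zero ∷ lift v))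
        ≡ unisolate a
  head≡ rewrite ∧-zeroʳ (k <ᵇ suc (toℕ y)) | descends-lift s (toℕ y) v = unisolate-mark (toℕ y <ᵇ s) (s <ᵇ toℕ y)
  rest≡ : marks (suc s) (suc k′ ⊔ 1) (lift v) ≡ marks s k′ v
  rest≡ rewrite ⊔-identityʳ k′ = marks-lift s k′ v

-- extensions t L counts the ways to insert t further letters below s, one
-- after the other in decreasing order, into a word with marks L, such that the
-- letters below s end up decreasing, s isolated and all larger letters not
-- isolated. Only the slots after the last smaller letter are available, and an
-- isolated larger letter must be followed by at least one insertion.

choices : Bool → (ℕ → ℕ) → ℕ → ℕ
choices true  h zero    = 0
choices true  h (suc t) = choices true h t + h t
choices false h zero    = h 0
choices false h (suc t) = choices false h t + h (suc t)

extensions : ℕ → Vec Mark m → ℕ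
extensions t []              = 1
extensions t (smaller d ∷ L) = if d then extensions t L else 0
extensions t (chosen i  ∷ L) = if i then extensions t L else 0
-- In `choices`, `t′` letters remain for the slots behind this one and the others go in front of it,
-- except that one is spent right behind it if it is isolated: hence `t′ ≤ t` or `t′ < t`. If a
-- smaller letter follows, the slots here are closed and `i` is final.
extensions t (larger i  ∷ L) =
  if noSmaller L then choices i (λ t′ → extensions t′ L) t else (if i then 0 else extensions t L)

if-0 : ∀ b → (if b then 0 else 0) ≡ 0
if-0 true  = refl
if-0 false = refl

noSmaller-markInsertAfter : {L : Vec Mark m} {K : Vec Mark (suc m)} → K ∈ˡ markInsertAfter L → noSmaller K ≡ false
noSmaller-markInsertAfter {L = smaller _ ∷ L} (here refl) = refl
noSmaller-markInsertAfter {L = chosen _  ∷ L} (here refl) = refl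
noSmaller-markInsertAfter {L = larger _  ∷ L} (here refl) = refl
noSmaller-markInsertAfter {L = a ∷ L} (there K∈) with ∈-map⁻ (a ∷_) K∈
noSmaller-markInsertAfter {L = smaller _ ∷ L} (there K∈) | K , K∈′ , refl = refl
noSmaller-markInsertAfter {L = chosen _  ∷ L} (there K∈) | K , K∈′ , refl = noSmaller-markInsertAfter K∈′
noSmaller-markInsertAfter {L = larger _  ∷ L} (there K∈) | K , K∈′ , refl = noSmaller-markInsertAfter K∈′

-- After an insertion further right, no later letter can go right behind this one, so an isolated
-- larger letter stays isolated.
∑-larger : ∀ t i (L : Vec Mark m) →
  ∑∈ (map (larger i ∷_) (markInsertAfter L)) (extensions t) ≡
  (if i then 0 else ∑∈ (markInsertAfter L) (extensions t))
∑-larger t i L = begin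
  ∑∈ (map (larger i ∷_) (markInsertAfter L)) (extensions t)
    ≡⟨ ∑∈-map (extensions t) (larger i ∷_) (markInsertAfter L) ⟩
  ∑∈ (markInsertAfter L) (extensions t ∘ (larger i ∷_))
    ≡⟨ ∑∈-cong-local {xs = markInsertAfter L} (All.tabulate λ {K} K∈ →
         cong (λ b → if b then choices i (λ t′ → extensions t′ K) t else (if i then 0 else extensions t K))
              (noSmaller-markInsertAfter K∈)) ⟩
  ∑∈ (markInsertAfter L) (λ K → if i then 0 else extensions t K)
    ≡⟨ pull i ⟩
  (if i then 0 else ∑∈ (markInsertAfter L) (extensions t)) ∎
  where
  pull : ∀ i → ∑∈ (markInsertAfter L) (λ K → if i then 0 else extensions t K) ≡
               (if i then 0 else ∑∈ (markInsertAfter L) (extensions t))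
  pull true  = ∑∈-zero (All.universal (λ _ → refl) (markInsertAfter L))
  pull false = refl

-- The `suc t` insertions are sorted by the place of the first: in front of the word, or after one
-- of its letters.
∑-extensions : ∀ t (L : Vec Mark m) →
  extensions t (smaller (noSmaller L) ∷ L) + ∑∈ (markInsertAfter L) (extensions t) ≡ extensions (suc t) L
∑-extensions t []                  = refl
∑-extensions t (smaller false ∷ L) =
  trans (∑∈-map (extensions t) (smaller false ∷_) (markInsertAfter L))
        (∑∈-zero (All.universal (λ _ → refl) (markInsertAfter L)))
∑-extensions t (smaller true  ∷ L) =
  trans (cong (extensions t (smaller (noSmaller L) ∷ L) +_) (∑∈-map (extensions t) (smaller true ∷_) (markInsertAfter L)))
        (∑-extensions t L)
∑-extensions t (chosen false ∷ L) = cong₂ _+_ (if-0 (noSmaller L))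
  (trans (∑∈-map (extensions t) (chosen false ∷_) (markInsertAfter L))
         (∑∈-zero (All.universal (λ _ → refl) (markInsertAfter L))))
-- Insertion before an isolated s stands in for the insertion right after it,
-- which would destroy the isolation.
∑-extensions t (chosen true  ∷ L) =
  trans (cong (extensions t (smaller (noSmaller L) ∷ L) +_) (∑∈-map (extensions t) (chosen true ∷_) (markInsertAfter L)))
        (∑-extensions t L)
∑-extensions t (larger i ∷ L) rewrite ∑-larger t i L with noSmaller L | ∑-extensions t L
... | false | IH = cong (if i then 0 else_) IH
... | true  | IH = both i
  where
  Σ = ∑∈ (markInsertAfter L) (extensions t)
  h = λ t → extensions t L
  -- The summands stand for the first insertion in front of the letter, right behind it, and further
  -- right. For a letter that is not isolated, the last two make up all insertions into `L`.
  both : ∀ i → choices i h t + (extensions t L + (if i then 0 else Σ)) ≡ choices i h (suc t)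
  both true  = cong (choices true h t +_) (+-identityʳ _)
  both false = cong (choices false h t +_) IH

∑-extensions-insertions : ∀ s t (v : Vec (Fin n) m) →
  ∑∈ (insertions v) (extensions t ∘ marks (suc s) 0) ≡ extensions (suc t) (marks s 0 v)
∑-extensions-insertions s t v = begin
  extensions t (smaller (descends (suc s) 0 (lift v)) ∷ marks (suc s) 1 (lift v)) +
  ∑∈ (insertAfter v) (extensions t ∘ marks (suc s) 0)
    ≡⟨ cong₂ _+_ (cong₂ (λ d L → extensions t (smaller d ∷ L)) (descends-0 s 0 v) (marks-lift s 0 v))
         (∑∈-cong-local (All.tabulate λ u∈ → cong (extensions t) (from-1 v u∈))) ⟩
  extensions t (smaller (noSmaller (marks s 0 v)) ∷ marks s 0 v) +
  ∑∈ (insertAfter v) (extensions t ∘ marks (suc s) 1)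
    ≡⟨ cong (extensions t (smaller (noSmaller (marks s 0 v)) ∷ marks s 0 v) +_)
         (∑∈-map (extensions t) (marks (suc s) 1) (insertAfter v)) ⟨
  extensions t (smaller (noSmaller (marks s 0 v)) ∷ marks s 0 v) +
  ∑∈ (map (marks (suc s) 1) (insertAfter v)) (extensions t)
    ≡⟨ cong (λ Ls → extensions t (smaller (noSmaller (marks s 0 v)) ∷ marks s 0 v) + ∑∈ Ls (extensions t))
         (marks-insertAfter s 0 v) ⟩
  extensions t (smaller (noSmaller (marks s 0 v)) ∷ marks s 0 v) +
  ∑∈ (markInsertAfter (marks s 0 v)) (extensions t)
    ≡⟨ ∑-extensions t (marks s 0 v) ⟩
  extensions (suc t) (marks s 0 v) ∎
  where
  from-1 : ∀ (v : Vec (Fin n) m) {u} → u ∈ˡ insertAfter v → marks (suc s) 0 u ≡ marks (suc s) 1 u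
  from-1 v {zero ∷ u}  u∈ with () ← zero∷∉insertAfter u∈
  from-1 v {suc y ∷ u} u∈ = refl

-- Each smallest letter that is stripped lowers `s` by one and becomes one more letter to be
-- inserted, until the chosen letter is the smallest.
∑𝒮-extensions : ∀ s t N →
  ∑∈ (𝒮 (s + N)) (extensions t ∘ marks s 0) ≡ ∑∈ (𝒮 N) (extensions (s + t) ∘ marks 0 0)
∑𝒮-extensions zero    t N = refl
∑𝒮-extensions (suc s) t N = begin
  ∑∈ (𝒮 (suc (s + N))) (extensions t ∘ marks (suc s) 0)
    ≡⟨ ∑𝒮-insertions (s + N) (extensions t ∘ marks (suc s) 0) ⟩
  ∑∈ (𝒮 (s + N)) (λ w → ∑∈ (insertions w) (extensions t ∘ marks (suc s) 0))
    ≡⟨ ∑∈-cong (𝒮 (s + N)) (∑-extensions-insertions s t) ⟩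
  ∑∈ (𝒮 (s + N)) (extensions (suc t) ∘ marks s 0)
    ≡⟨ ∑𝒮-extensions s (suc t) N ⟩
  ∑∈ (𝒮 N) (extensions (s + suc t) ∘ marks 0 0)
    ≡⟨ cong (λ t′ → ∑∈ (𝒮 N) (extensions t′ ∘ marks 0 0)) (+-suc s t) ⟩
  ∑∈ (𝒮 N) (extensions (suc s + t) ∘ marks 0 0) ∎

noSmaller-larger : (b : Vec Bool m) → noSmaller (Vec.map larger b) ≡ true
noSmaller-larger []      = refl
noSmaller-larger (_ ∷ b) = noSmaller-larger b

-- Stars and bars: `t` letters go into `m + 1` slots, with at least one in each of the
-- `m ∸ unflagged b` slots behind isolated letters. The induction is Pascal's rule;
-- `unflagged b ≤ m` makes the boundary term vanish.
extensions-larger : ∀ t (b : Vec Bool m) → extensions t (Vec.map larger b) ≡ (t + unflagged b) C m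
extensions-larger t []                = sym (tC0 (t + 0))
  where
  tC0 : ∀ t → t C 0 ≡ 1
  tC0 _ = refl
extensions-larger {suc m} t (i ∷ b) rewrite noSmaller-larger b = by i t
  where
  u = unflagged b
  h : ℕ → ℕ
  h t = extensions t (Vec.map larger b)
  uCm+1≡0 : u C suc m ≡ 0
  uCm+1≡0 = k>n⇒nCk≡0 (s≤s (unflagged≤ b))
  by : ∀ i t → choices i h t ≡ (t + unflagged (i ∷ b)) C suc m
  by true  zero    = sym uCm+1≡0
  by true  (suc t) = begin
    choices true h t + h t               ≡⟨ cong₂ _+_ (by true t) (extensions-larger t b) ⟩
    (t + u) C suc m + (t + u) C m        ≡⟨ +-comm ((t + u) C suc m) _ ⟩
    (t + u) C m + (t + u) C suc m        ≡⟨ nCk+nC[k+1]≡[n+1]C[k+1] (t + u) m ⟩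
    suc (t + u) C suc m                  ∎
  by false zero    = begin
    h 0                                  ≡⟨ extensions-larger 0 b ⟩
    u C m                                ≡⟨ +-identityʳ (u C m) ⟨
    u C m + 0                            ≡⟨ cong (u C m +_) uCm+1≡0 ⟨
    u C m + u C suc m                    ≡⟨ nCk+nC[k+1]≡[n+1]C[k+1] u m ⟩
    suc u C suc m                        ∎
  by false (suc t) = begin
    choices false h t + h (suc t)        ≡⟨ cong₂ _+_ (by false t) (extensions-larger (suc t) b) ⟩
    (t + suc u) C suc m + (suc t + u) C m
      ≡⟨ cong (λ x → (t + suc u) C suc m + x C m) (+-suc t u) ⟨
    (t + suc u) C suc m + (t + suc u) C m ≡⟨ +-comm ((t + suc u) C suc m) _ ⟩
    (t + suc u) C m + (t + suc u) C suc m ≡⟨ nCk+nC[k+1]≡[n+1]C[k+1] (t + suc u) m ⟩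
    suc (t + suc u) C suc m              ∎

marks-0 : ∀ k (v : Vec (Fin n) m) → marks 0 (suc k) (lift v) ≡ Vec.map larger (isolations k v)
marks-0 k []      = refl
marks-0 k (x ∷ v) = cong₂ _∷_ (cong larger (isolated-lift k x v)) (marks-0 _ v)

choices-0 : ∀ i {h} → (∀ t → h t ≡ 0) → ∀ t → choices i h t ≡ 0
choices-0 true  h≡0 zero    = refl
choices-0 true  h≡0 (suc t) = cong₂ _+_ (choices-0 true h≡0 t) (h≡0 t)
choices-0 false h≡0 zero    = h≡0 0
choices-0 false h≡0 (suc t) = cong₂ _+_ (choices-0 false h≡0 t) (h≡0 (suc t))

extensions-larger-0 : ∀ (L : Vec Mark m) i → (∀ t → extensions t L ≡ 0) → ∀ t → extensions t (larger i ∷ L) ≡ 0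
extensions-larger-0 L i none t with noSmaller L
... | true = choices-0 i none t
extensions-larger-0 L true  none t | false = refl
extensions-larger-0 L false none t | false = none t

-- The chosen letter is now zero. Behind another letter it is no left-to-right maximum, hence not
-- isolated, so only the insertion in front contributes.
extensions-insertAfter-0 : ∀ k {v : Vec (Fin n) m} {u} → u ∈ˡ insertAfter v →
                           ∀ t → extensions t (marks 0 (suc k) u) ≡ 0
extensions-insertAfter-0 k {y ∷ v} (here refl) =
  extensions-larger-0 (marks 0 (suc (k ⊔ suc (toℕ y))) (zero ∷ lift v)) (isolated (suc k) (suc y) (zero ∷ lift v)) λ t → refl
extensions-insertAfter-0 k {y ∷ v} (there u∈) with ∈-map⁻ (suc y ∷_) u∈
... | u , u∈′ , refl = extensions-larger-0 (marks 0 _ u) (isolated (suc k) (suc y) u) (extensions-insertAfter-0 _ u∈′)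

∑-extensions-insertions-0 : ∀ t (v : Vec (Fin n) m) →
  ∑∈ (insertions v) (extensions t ∘ marks 0 0) ≡ (t + unflagged (isolations 0 v)) C m
∑-extensions-insertions-0 {m = m} t v = begin
  extensions t (chosen (opens 1 (lift v)) ∷ marks 0 1 (lift v)) + ∑∈ (insertAfter v) (extensions t ∘ marks 0 0)
    ≡⟨ cong₂ _+_ (cong₂ (λ i L → extensions t (chosen i ∷ L)) (opens-1-lift v) (marks-0 0 v))
         (∑∈-zero (All.tabulate (none v))) ⟩
  extensions t (Vec.map larger (isolations 0 v)) + 0
    ≡⟨ +-identityʳ _ ⟩
  extensions t (Vec.map larger (isolations 0 v))
    ≡⟨ extensions-larger t (isolations 0 v) ⟩
  (t + unflagged (isolations 0 v)) C m ∎
  where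
  none : ∀ (v : Vec (Fin n) m) {u} → u ∈ˡ insertAfter v → extensions t (marks 0 0 u) ≡ 0
  none v {zero ∷ u}  u∈ with () ← zero∷∉insertAfter u∈
  none v {suc y ∷ u} u∈ = extensions-insertAfter-0 0 u∈ t

good : Mark → Bool
good (smaller d) = d
good (chosen i)  = i
good (larger i)  = not i

allGood : Vec Mark m → Bool
allGood []      = true
allGood (a ∷ L) = good a ∧ allGood L

extensions-none : (L : Vec Mark m) → extensions 0 L ≡ ⟦ allGood L ⟧
extensions-none []                  = refl
extensions-none (smaller true  ∷ L) = extensions-none L
extensions-none (smaller false ∷ L) = refl
extensions-none (chosen true   ∷ L) = extensions-none L
extensions-none (chosen false  ∷ L) = refl
extensions-none (larger i      ∷ L) with noSmaller L
extensions-none (larger true   ∷ L) | true  = refl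
extensions-none (larger false  ∷ L) | true  = extensions-none L
extensions-none (larger true   ∷ L) | false = refl
extensions-none (larger false  ∷ L) | false = extensions-none L

-- The `s` letters below the chosen one are stripped first, then the chosen one itself; what remains
-- depends on a word of length `N` only through its number of letters that are not isolated.
∑𝒮-allGood : ∀ s N → ∑∈ (𝒮 (s + suc N)) (⟦_⟧ ∘ allGood ∘ marks s 0) ≡
                     ∑< (suc N) (λ k → (N C k) * ((s + k) C N) * D k)
∑𝒮-allGood s N = begin
  ∑∈ (𝒮 (s + suc N)) (⟦_⟧ ∘ allGood ∘ marks s 0)
    ≡⟨ ∑∈-cong (𝒮 (s + suc N)) (λ π → extensions-none (marks s 0 π)) ⟨
  ∑∈ (𝒮 (s + suc N)) (extensions 0 ∘ marks s 0)
    ≡⟨ ∑𝒮-extensions s 0 (suc N) ⟩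
  ∑∈ (𝒮 (suc N)) (extensions (s + 0) ∘ marks 0 0)
    ≡⟨ cong (λ t → ∑∈ (𝒮 (suc N)) (extensions t ∘ marks 0 0)) (+-identityʳ s) ⟩
  ∑∈ (𝒮 (suc N)) (extensions s ∘ marks 0 0)
    ≡⟨ ∑𝒮-insertions N (extensions s ∘ marks 0 0) ⟩
  ∑∈ (𝒮 N) (λ w → ∑∈ (insertions w) (extensions s ∘ marks 0 0))
    ≡⟨ ∑∈-cong (𝒮 N) (∑-extensions-insertions-0 s) ⟩
  ∑∈ (𝒮 N) (λ w → (s + unflagged (isolations 0 w)) C N)
    ≡⟨ ∑𝒮-isolations N (λ x → (s + x) C N) ⟩
  E N (λ x → (s + x) C N)
    ≡⟨ E-closed N (λ x → (s + x) C N) ⟩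
  ∑< (suc N) (λ k → (N C k) * D k * ((s + k) C N))
    ≡⟨ ∑<-cong (suc N) (λ {k} _ → swap (N C k) (D k) ((s + k) C N)) ⟩
  ∑< (suc N) (λ k → (N C k) * ((s + k) C N) * D k) ∎
  where
  swap : ∀ a b c → a * b * c ≡ a * c * b
  swap = solve-∀

-- Fixed points of the map induced by the cycles

open Equivalence

letters : List (List⁺ (Fin n)) → List (Fin n)
letters = concatMap List⁺.toList

unique-++⁻ : ∀ {A : Set} (xs : List A) {ys} → Uniqueˡ (xs ++ ys) →
             Uniqueˡ xs × Uniqueˡ ys × (∀ {x} → x ∈ˡ xs → x ∉ ys)
unique-++⁻ []       ys!         = [] , ys! , λ ()
unique-++⁻ (x ∷ xs) (x∉ ∷ xys!) with unique-++⁻ xs xys!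
... | xs! , ys! , disjoint = Allₚ.++⁻ˡ xs x∉ ∷ xs! , ys! , λ where
  (here refl) x∈ys → All.lookup (Allₚ.++⁻ʳ xs x∉) x∈ys refl
  (there x∈)  x∈ys → disjoint x∈ x∈ys

successor-∉ : ∀ c₁ (cs : List (Fin n)) {x} → x ∉ cs → successor c₁ cs x ≡ x
successor-∉ c₁ []           x∉ = refl
successor-∉ c₁ (c ∷ [])     {x} x∉ with x ≟ c
... | yes x≡c = contradiction (here x≡c) x∉
... | no  _   = refl
successor-∉ c₁ (c ∷ d ∷ cs) {x} x∉ with x ≟ c | successor-∉ c₁ (d ∷ cs) (x∉ ∘ there)
... | yes x≡c | _  = contradiction (here x≡c) x∉
... | no  _   | IH = IH

successor-∈ : ∀ c₁ (cs : List (Fin n)) {x} → x ∈ˡ cs → successor c₁ cs x ∈ˡ c₁ ∷ cs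
successor-∈ c₁ (c ∷ [])     {x} x∈ with x ≟ c
... | yes _ = here refl
... | no  _ = there x∈
successor-∈ c₁ (c ∷ d ∷ cs) {x} x∈ with x ≟ c | x∈
... | yes _   | _         = there (there (here refl))
... | no  x≢c | here x≡c  = contradiction x≡c x≢c
... | no  _   | there x∈′ with successor-∈ c₁ (d ∷ cs) x∈′
...   | here eq  = here eq
...   | there ∈′ = there (there ∈′)

-- A letter before the last goes to its neighbour, distinct from it; the last goes to `c₁`, which
-- lies outside `cs`.
successor-moves : ∀ c₁ (cs : List (Fin n)) {x} → c₁ ∉ cs → Uniqueˡ cs → x ∈ˡ cs → successor c₁ cs x ≢ x
successor-moves c₁ (c ∷ [])     {x} c₁∉ _ (here refl) eq with x ≟ x
... | yes _  = c₁∉ (here eq)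
... | no x≢x = x≢x refl
successor-moves c₁ (c ∷ d ∷ cs) {x} c₁∉ ((c≢d ∷ _) ∷ cs!) x∈ eq with x ≟ c | x∈
... | yes refl | _         = c≢d (sym eq)
... | no x≢c   | here x≡c  = x≢c x≡c
... | no _     | there x∈′ = successor-moves c₁ (d ∷ cs) (c₁∉ ∘ there) cs! x∈′ eq

cycleMap-∉ : ∀ (c : List⁺ (Fin n)) {x} → x ∉ List⁺.toList c → cycleMap c x ≡ x
cycleMap-∉ (c₁ ∷ cs) = successor-∉ c₁ (c₁ ∷ cs)

cycleMap-∈ : ∀ (c : List⁺ (Fin n)) {x} → x ∈ˡ List⁺.toList c → cycleMap c x ∈ˡ List⁺.toList c
cycleMap-∈ (c₁ ∷ cs) x∈ with successor-∈ c₁ (c₁ ∷ cs) x∈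
... | here eq = here eq
... | there ∈ = ∈

cycleMap-fixed⁻ : ∀ (c : List⁺ (Fin n)) {x} → Uniqueˡ (List⁺.toList c) → x ∈ˡ List⁺.toList c →
                  cycleMap c x ≡ x → c ≡ x ∷ []
cycleMap-fixed⁻ (c₁ ∷ [])     _                     (here refl) _  = refl
cycleMap-fixed⁻ (c₁ ∷ d ∷ cs) {x} ((c₁≢d ∷ c₁∉) ∷ cs!) x∈     eq with x ≟ c₁ | x∈
... | yes refl | _         = contradiction (sym eq) c₁≢d
... | no x≢c₁  | here x≡c₁ = contradiction x≡c₁ x≢c₁
... | no _     | there x∈′ =
  contradiction eq (successor-moves c₁ (d ∷ cs) (λ c₁∈ → All.lookup (c₁≢d ∷ c₁∉) c₁∈ refl) cs! x∈′)

cycleMap-fixed⁺ : ∀ (x : Fin n) → cycleMap (x ∷ []) x ≡ x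
cycleMap-fixed⁺ x with x ≟ x
... | yes _ = refl
... | no _  = refl

compose : List (List⁺ (Fin n)) → Fin n → Fin n
compose = foldr (λ c f → cycleMap c ∘ f) id

compose-∉ : ∀ (cs : List (List⁺ (Fin n))) {x} → x ∉ letters cs → compose cs x ≡ x
compose-∉ []       x∉ = refl
compose-∉ (c ∷ cs) x∉ = trans
  (cong (cycleMap c) (compose-∉ cs (x∉ ∘ ∈-++⁺ʳ (List⁺.toList c))))
  (cycleMap-∉ c (x∉ ∘ ∈-++⁺ˡ))

-- Guarantees that a further cycle, disjoint from `cs`, leaves the images under `compose cs` alone.
compose-∈ : ∀ (cs : List (List⁺ (Fin n))) {x} → Uniqueˡ (letters cs) → x ∈ˡ letters cs → compose cs x ∈ˡ letters cs
compose-∈ (c ∷ cs) cs! x∈ with unique-++⁻ (List⁺.toList c) cs! | ∈-++⁻ (List⁺.toList c) x∈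
... | _ , _ , disjoint | inj₁ x∈c =
  subst (_∈ˡ letters (c ∷ cs)) (sym (cong (cycleMap c) (compose-∉ cs (disjoint x∈c)))) (∈-++⁺ˡ (cycleMap-∈ c x∈c))
... | _ , cs!′ , disjoint | inj₂ x∈cs =
  subst (_∈ˡ letters (c ∷ cs)) (sym (cycleMap-∉ c λ ∈c → disjoint ∈c (compose-∈ cs cs!′ x∈cs)))
        (∈-++⁺ʳ (List⁺.toList c) (compose-∈ cs cs!′ x∈cs))

-- As the cycles are disjoint, only the one containing `x` acts on `x`, and a cycle with a fixed
-- letter has length one.
compose-fixed⁻ : ∀ (cs : List (List⁺ (Fin n))) {x} → Uniqueˡ (letters cs) → x ∈ˡ letters cs →
                 compose cs x ≡ x → (x ∷ []) ∈ˡ cs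
compose-fixed⁻ (c ∷ cs) cs! x∈ eq with unique-++⁻ (List⁺.toList c) cs! | ∈-++⁻ (List⁺.toList c) x∈
... | c! , _ , disjoint | inj₁ x∈c =
  here (sym (cycleMap-fixed⁻ c c! x∈c (trans (sym (cong (cycleMap c) (compose-∉ cs (disjoint x∈c)))) eq)))
... | _ , cs!′ , disjoint | inj₂ x∈cs =
  there (compose-fixed⁻ cs cs!′ x∈cs (trans (sym (cycleMap-∉ c λ ∈c → disjoint ∈c (compose-∈ cs cs!′ x∈cs))) eq))

singleton-∈-letters : ∀ {cs : List (List⁺ (Fin n))} {x} → (x ∷ []) ∈ˡ cs → x ∈ˡ letters cs
singleton-∈-letters                (here refl) = here refl
singleton-∈-letters {cs = c ∷ cs} (there x∈)  = ∈-++⁺ʳ (List⁺.toList c) (singleton-∈-letters x∈)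

compose-fixed⁺ : ∀ (cs : List (List⁺ (Fin n))) {x} → Uniqueˡ (letters cs) → (x ∷ []) ∈ˡ cs → compose cs x ≡ x
compose-fixed⁺ (_ ∷ cs) {x} (x∉ ∷ _) (here refl) =
  trans (cong (cycleMap (x ∷ [])) (compose-∉ cs λ x∈ → All.lookup x∉ x∈ refl)) (cycleMap-fixed⁺ x)
compose-fixed⁺ (c ∷ cs) {x} cs! (there x∈) with unique-++⁻ (List⁺.toList c) cs!
... | _ , cs!′ , disjoint =
  trans (cong (cycleMap c) (compose-fixed⁺ cs cs!′ x∈)) (cycleMap-∉ c λ x∈c → disjoint x∈c (singleton-∈-letters x∈))

data Isolated (c : Fin n) : ℕ → Vec (Fin n) m → Set where
  here  : ∀ {k} {v : Vec (Fin n) m} → T (isolated k c v) → Isolated c k (c ∷ v)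
  there : ∀ {k x} {v : Vec (Fin n) m} → Isolated c (k ⊔ suc (toℕ x)) v → Isolated c k (x ∷ v)

-- Links the letters seen by `splitAtMaxima` to the numerical bound: all that matters is that both
-- give the same test for left-to-right maxima.
record Bounds (k : ℕ) (seen : List (Fin n)) : Set where
  field maximum≡ : ∀ (x : Fin n) → does (All.all? (_<? x) seen) ≡ (k <ᵇ suc (toℕ x))

open Bounds

⊔-<ᵇ : ∀ a b c → ((a ⊔ b) <ᵇ c) ≡ (a <ᵇ c) ∧ (b <ᵇ c)
⊔-<ᵇ a       b       zero    = refl
⊔-<ᵇ zero    b       (suc c) = refl
⊔-<ᵇ (suc a) zero    (suc c) = sym (∧-comm (a <ᵇ c) true)
⊔-<ᵇ (suc a) (suc b) (suc c) = ⊔-<ᵇ a b c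

Bounds-∷ : ∀ {k} {seen : List (Fin n)} y → Bounds k seen → Bounds (k ⊔ suc (toℕ y)) (y ∷ seen)
Bounds-∷ {k = k} y bound .maximum≡ x =
  trans (cong ((toℕ y <ᵇ toℕ x) ∧_) (maximum≡ bound x))
        (trans (∧-comm (toℕ y <ᵇ toℕ x) _) (sym (⊔-<ᵇ k (suc (toℕ y)) (suc (toℕ x)))))

letters-split : ∀ seen (w : List (Fin n)) →
  proj₁ (splitAtMaxima seen w) ++ letters (proj₂ (splitAtMaxima seen w)) ≡ w
letters-split seen []      = refl
letters-split seen (x ∷ w) with does (All.all? (_<? x) seen)
... | true  = cong (x ∷_) (letters-split (x ∷ seen) w)
... | false = cong (x ∷_) (letters-split (x ∷ seen) w)

split-opens⁻ : ∀ {k seen} (v : Vec (Fin n) m) → Bounds k seen →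
               proj₁ (splitAtMaxima seen (toList v)) ≡ [] → T (opens k v)
split-opens⁻ []      bound _ = tt
split-opens⁻ {seen = seen} (x ∷ v) bound _ with does (All.all? (_<? x) seen) in eq
... | true = subst T (trans (sym eq) (maximum≡ bound x)) tt

split-opens⁺ : ∀ {k seen} (v : Vec (Fin n) m) → Bounds k seen →
               T (opens k v) → proj₁ (splitAtMaxima seen (toList v)) ≡ []
split-opens⁺ []      bound _ = refl
split-opens⁺ {seen = seen} (x ∷ v) bound x-max with does (All.all? (_<? x) seen) in eq
... | true  = refl
... | false = ⊥-elim (subst T (trans (sym (maximum≡ bound x)) eq) x-max)

-- A block has one letter just when no letters precede the next maximum, that is, when the first
-- component returned for the tail is empty.
split-isolated⁻ : ∀ {k seen} (v : Vec (Fin n) m) {c} → Bounds k seen →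
                  (c ∷ []) ∈ˡ proj₂ (splitAtMaxima seen (toList v)) → Isolated c k v
split-isolated⁻ {k = k} {seen} (x ∷ v) bound c∈ with does (All.all? (_<? x) seen) in eq
... | false = there (split-isolated⁻ v (Bounds-∷ x bound) c∈)
... | true  with splitAtMaxima (x ∷ seen) (toList v) | split-opens⁻ v (Bounds-∷ x bound)
               | split-isolated⁻ v (Bounds-∷ x bound) | c∈
...   | [] , _ | opens-v | _  | here refl = here (from T-∧ (subst T (trans (sym eq) (maximum≡ bound x)) tt , opens-v refl))
...   | _  , _ | _       | IH | there c∈′ = there (IH c∈′)

split-isolated⁺ : ∀ {k seen} (v : Vec (Fin n) m) {c} → Bounds k seen →
                  Isolated c k v → (c ∷ []) ∈ˡ proj₂ (splitAtMaxima seen (toList v))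
split-isolated⁺ {k = k} {seen} (x ∷ v) bound (there c-iso)
  with does (All.all? (_<? x) seen) | split-isolated⁺ v (Bounds-∷ x bound) c-iso
... | true  | c∈ = there c∈
... | false | c∈ = c∈
split-isolated⁺ {k = k} {seen} (x ∷ v) bound (here c-iso)
  with does (All.all? (_<? x) seen) in eq | to T-∧ c-iso
... | true  | _ , opens-v = here (cong (x ∷_) (sym (split-opens⁺ v (Bounds-∷ x bound) opens-v)))
... | false | x-max , _ = ⊥-elim (subst T (trans (sym (maximum≡ bound x)) eq) x-max)

toList-unique : {v : Vec (Fin n) m} → Unique v → Uniqueˡ (toList v)
toList-unique []         = []
toList-unique (x∉v ∷ v!) = VAllₚ.toList⁺ x∉v ∷ toList-unique v!

Bounds-[] : Bounds {n} 0 []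
Bounds-[] .maximum≡ x = refl

letters-cycles : (π : Word n) → letters (cycles π) ≡ toList π
letters-cycles π =
  trans (cong (_++ letters (cycles π)) (sym (split-opens⁺ π Bounds-[] (opens-0 π)))) (letters-split [] (toList π))
  where
  opens-0 : (v : Vec (Fin n) m) → T (opens 0 v)
  opens-0 []      = tt
  opens-0 (_ ∷ _) = tt

-- The cycles are the blocks of the word, disjoint because its letters are distinct; a fixed point
-- is a block of one letter.
hat-fixed⇔isolated : {π : Word n} → Unique π → ∀ c → hat π c ≡ c ⇔ Isolated c 0 π
hat-fixed⇔isolated {π = π} π! c = mk⇔
  (split-isolated⁻ π Bounds-[] ∘ compose-fixed⁻ (cycles π) cycles! c∈)
  (compose-fixed⁺ (cycles π) cycles! ∘ split-isolated⁺ π Bounds-[])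
  where
  cycles! : Uniqueˡ (letters (cycles π))
  cycles! = subst Uniqueˡ (sym (letters-cycles π)) (toList-unique π!)
  c∈ : c ∈ˡ letters (cycles π)
  c∈ = subst (c ∈ˡ_) (sym (letters-cycles π)) (∈-toList⁺ (∈-unique π! c))

-- Avoidance

does≡ : ∀ {A : Set} {b} (A? : Dec A) → A ⇔ T b → does A? ≡ b
does≡ {b = true}  (yes _)  _   = refl
does≡ {b = true}  (no ¬a)  A⇔b = contradiction (from A⇔b tt) ¬a
does≡ {b = false} (yes a)  A⇔b = ⊥-elim (to A⇔b a)
does≡ {b = false} (no _)   _   = refl

⟦⟧≡0 : ∀ {b} → ¬ T b → ⟦ b ⟧ ≡ 0
⟦⟧≡0 {true}  ¬b = contradiction tt ¬b
⟦⟧≡0 {false} ¬b = refl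

⟦⟧≡1 : ∀ {b} → T b → ⟦ b ⟧ ≡ 1
⟦⟧≡1 {true} _ = refl

length-filter≡∑ : ∀ {A : Set} {P : A → Set} (P? : Decidable P) xs → length (filter P? xs) ≡ ∑∈ xs (⟦_⟧ ∘ does ∘ P?)
length-filter≡∑ P? []       = refl
length-filter≡∑ P? (x ∷ xs) with does (P? x)
... | true  = cong suc (length-filter≡∑ P? xs)
... | false = length-filter≡∑ P? xs

-- The number of cleared flags is at most the length, and a single set flag keeps it below. Here `k`
-- is the position of the first letter.
nowhere-fixed : ∀ k (v : Vec (Fin n) m) →
                (∀ i → toℕ (lookup v i) ≢ toℕ i + k) ⇔ T (m ≡ᵇ unflagged (fixes k v))
nowhere-fixed         k []      = mk⇔ (λ _ → tt) (λ _ ())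
nowhere-fixed {m = suc m} k (x ∷ v) with toℕ x ≡ᵇ k in eq
... | true  = mk⇔
  (λ moved → contradiction (≡ᵇ⇒≡ (toℕ x) k (subst T (sym eq) tt)) (moved zero))
  (λ full → contradiction (unflagged≤ (fixes (suc k) v)) (<⇒≱ (≤-reflexive (≡ᵇ⇒≡ (suc m) _ full))))
... | false = mk⇔
  (λ moved → to (nowhere-fixed (suc k) v) λ i fixed → moved (suc i) (trans fixed (+-suc (toℕ i) k)))
  (λ full → λ where
    zero    fixed → subst T eq (≡⇒≡ᵇ (toℕ x) k fixed)
    (suc i) fixed → from (nowhere-fixed (suc k) v) full i (trans fixed (sym (+-suc (toℕ i) k))))

derangement⇔ : (π : Word n) → Derangement π ⇔ T (n ≡ᵇ unflagged (fixes 0 π))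
derangement⇔ π = mk⇔
  (λ moved → to (nowhere-fixed 0 π) λ i fixed → moved i (toℕ-injective (trans fixed (+-identityʳ (toℕ i)))))
  (λ full i fixed → from (nowhere-fixed 0 π) full i (trans (cong toℕ fixed) (sym (+-identityʳ (toℕ i)))))

d≡E : ∀ n → d n ≡ E n (λ x → ⟦ n ≡ᵇ x ⟧)
d≡E n = begin
  d n                                                  ≡⟨ length-filter≡∑ derangement? (𝒮 n) ⟩
  ∑∈ (𝒮 n) (⟦_⟧ ∘ does ∘ derangement?)
    ≡⟨ ∑∈-cong (𝒮 n) (λ π → cong ⟦_⟧ (does≡ (derangement? π) (derangement⇔ π))) ⟩
  ∑∈ (𝒮 n) (λ π → ⟦ n ≡ᵇ unflagged (fixes 0 π) ⟧)      ≡⟨ ∑𝒮-fixes n (λ x → ⟦ n ≡ᵇ x ⟧) ⟩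
  E n (λ x → ⟦ n ≡ᵇ x ⟧)                               ∎

-- Both are the value of `E` at the indicator of the largest possible statistic: `D` by the closed
-- form, `d` by counting permutations.
D≡d : ∀ n → D n ≡ d n
D≡d n = trans (sym (E-top n)) (sym (d≡E n))

isolated-∈ : ∀ {c k} {v : Vec (Fin n) m} → Isolated c k v → c ∈ v
isolated-∈ (here _)      = here refl
isolated-∈ (there c-iso) = there (isolated-∈ c-iso)

none-isolated : ∀ k (v : Vec (Fin n) m) → (∀ c → ¬ Isolated c k v) ⇔ T (m ≡ᵇ unflagged (isolations k v))
none-isolated             k []      = mk⇔ (λ _ → tt) (λ _ _ ())
none-isolated {m = suc m} k (x ∷ v) with isolated k x v in eq
... | true  = mk⇔
  (λ none → contradiction (here (subst T (sym eq) tt)) (none x))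
  (λ full → contradiction (unflagged≤ (isolations _ v)) (<⇒≱ (≤-reflexive (≡ᵇ⇒≡ (suc m) _ full))))
... | false = mk⇔
  (λ none → to (none-isolated _ v) λ c → none c ∘ there)
  (λ full c → λ where
    (here x-iso)  → subst T eq x-iso
    (there c-iso) → from (none-isolated _ v) full c c-iso)

-- An occurrence of 12 with both letters below `s`, in a form that follows the recursion of `marks`.
data Ascent (s : ℕ) : Vec (Fin n) m → Set where
  here  : ∀ {x} {v : Vec (Fin n) m} → Any (λ y → toℕ x < toℕ y × toℕ y < s) v → Ascent s (x ∷ v)
  there : ∀ {x} {v : Vec (Fin n) m} → Ascent s v → Ascent s (x ∷ v)

ascent-mono : ∀ {s s′} {v : Vec (Fin n) m} → s ≤ s′ → Ascent s v → Ascent s′ v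
ascent-mono s≤s′ (here x<y<s) = here (VAny.map (λ (x<y , y<s) → x<y , <-≤-trans y<s s≤s′) x<y<s)
ascent-mono s≤s′ (there asc)  = there (ascent-mono s≤s′ asc)

ascent⁺ : ∀ {s} (v : Vec (Fin n) m) {i j} → i Fin.< j → lookup v i Fin.< lookup v j → toℕ (lookup v j) < s → Ascent s v
ascent⁺ (x ∷ v) {zero}  {suc j} _         vᵢ<vⱼ vⱼ<s = here (VAny-lookup j (vᵢ<vⱼ , vⱼ<s))
  where
  VAny-lookup : ∀ {P : Fin n → Set} {m} {v : Vec (Fin n) m} j → P (lookup v j) → Any P v
  VAny-lookup {v = _ ∷ _} zero    p = here p
  VAny-lookup {v = _ ∷ _} (suc j) p = there (VAny-lookup j p)
ascent⁺ (x ∷ v) {suc i} {suc j} (s≤s i<j) vᵢ<vⱼ vⱼ<s = there (ascent⁺ v i<j vᵢ<vⱼ vⱼ<s)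

ascent⁻ : ∀ {s} {v : Vec (Fin n) m} → Ascent s v →
          ∃₂ λ i j → i Fin.< j × lookup v i Fin.< lookup v j × toℕ (lookup v j) < s
ascent⁻ (here asc) = zero , suc (VAny.index asc) , z<s , lookup-index asc
ascent⁻ (there asc) with ascent⁻ asc
... | i , j , i<j , rest = suc i , suc j , s<s i<j , rest

contains⇔ : (π : Word n) → Contains π [12⨾3→3] ⇔ (∃ λ c → hat π c ≡ c × Ascent (toℕ c) π)
contains⇔ π = mk⇔ forth back
  where
  forth : Contains π [12⨾3→3] → ∃ λ c → hat π c ≡ c × Ascent (toℕ c) π
  forth (x₁ ∷ x₂ ∷ x₃ ∷ [] , (x₁<x₂ ∷ _) ∷ (x₂<x₃ ∷ []) ∷ _ ,
         (i ∷ j ∷ [] , (i<j ∷ []) ∷ _ , refl) , x₃-fixed ∷ []) =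
    x₃ , x₃-fixed , ascent⁺ π i<j x₁<x₂ x₂<x₃
  back : (∃ λ c → hat π c ≡ c × Ascent (toℕ c) π) → Contains π [12⨾3→3]
  back (c , c-fixed , asc) with ascent⁻ asc
  ... | i , j , i<j , πᵢ<πⱼ , πⱼ<c =
    lookup π i ∷ lookup π j ∷ c ∷ [] ,
    (πᵢ<πⱼ ∷ <-trans πᵢ<πⱼ πⱼ<c ∷ []) ∷ (πⱼ<c ∷ []) ∷ [] ∷ [] ,
    (i ∷ j ∷ [] , (i<j ∷ []) ∷ [] ∷ [] , refl) , c-fixed ∷ []

descends⇔ : ∀ s x (v : Vec (Fin n) m) → T (descends s x v) ⇔ (¬ Any (λ y → x < toℕ y × toℕ y < s) v)
descends⇔ s x []      = mk⇔ (λ _ ()) (λ _ → tt)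
descends⇔ s x (y ∷ v) with x <ᵇ toℕ y in x<y | toℕ y <ᵇ s in y<s
... | true  | true  = mk⇔ (λ ()) (λ none → none (here (<ᵇ⇒< x _ (subst T (sym x<y) tt) , <ᵇ⇒< _ s (subst T (sym y<s) tt))))
... | true  | false = mk⇔
  (λ desc → λ where
    (here (_ , lt)) → subst T y<s (<⇒<ᵇ lt)
    (there any)     → to (descends⇔ s x v) desc any)
  (λ none → from (descends⇔ s x v) (none ∘ there))
... | false | _     = mk⇔
  (λ desc → λ where
    (here (lt , _)) → subst T x<y (<⇒<ᵇ lt)
    (there any)     → to (descends⇔ s x v) desc any)
  (λ none → from (descends⇔ s x v) (none ∘ there))

data MarkView (s x : ℕ) (i d : Bool) : Mark → Set where
  is-smaller : x < s → MarkView s x i d (smaller d)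
  is-chosen  : x ≡ s → MarkView s x i d (chosen i)
  is-larger  : s < x → MarkView s x i d (larger i)

markView : ∀ s x i d → MarkView s x i d (mark (x <ᵇ s) (s <ᵇ x) i d)
markView s x i d with x <ᵇ s in x<s | s <ᵇ x in s<x
... | true  | _     = is-smaller (<ᵇ⇒< x s (subst T (sym x<s) tt))
... | false | true  = is-larger (<ᵇ⇒< s x (subst T (sym s<x) tt))
... | false | false = is-chosen (≤-antisym (≮⇒≥ (subst T s<x ∘ <⇒<ᵇ)) (≮⇒≥ (subst T x<s ∘ <⇒<ᵇ)))

-- s is the largest isolated letter of v, and the letters below it decrease.

record Tops (s k : ℕ) (v : Vec (Fin n) m) : Set where
  field
    isolated≤ : ∀ {c} → Isolated c k v → toℕ c ≤ s
    s-isolated : ∀ {c} → c ∈ v → toℕ c ≡ s → Isolated c k v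
    no-ascent : ¬ Ascent s v

open Tops

-- `good` is the share of the head in the three conditions. They pass to suffixes since `s-isolated`
-- speaks only of occurrences of `s`, and a suffix may have none.
tops⁻ : ∀ s k (v : Vec (Fin n) m) → T (allGood (marks s k v)) → Tops s k v
tops⁻ s k []      _  = record { isolated≤ = λ () ; s-isolated = λ () ; no-ascent = λ () }
tops⁻ s k (x ∷ v) ok = record
  { isolated≤  = λ { (here x-iso) → head≤ view good-a x-iso ; (there c-iso) → isolated≤ rest c-iso }
  ; s-isolated = λ { (here refl) x≡s → here (head-isolated view good-a x≡s) ; (there c∈) c≡s → there (s-isolated rest c∈ c≡s) }
  ; no-ascent  = λ { (here asc) → head-descends view good-a asc ; (there asc) → no-ascent rest asc }
  }
  where
  ok′ = to T-∧ ok
  good-a = proj₁ ok′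
  view = markView s (toℕ x) (isolated k x v) (descends s (toℕ x) v)
  rest = tops⁻ s _ v (proj₂ ok′)
  head≤ : ∀ {a i d} → MarkView s (toℕ x) i d a → T (good a) → T i → toℕ x ≤ s
  head≤ (is-smaller x<s) _ _ = <⇒≤ x<s
  head≤ (is-chosen x≡s)  _ _ = ≤-reflexive x≡s
  head≤ {i = true} (is-larger _) () _
  head-isolated : ∀ {a i d} → MarkView s (toℕ x) i d a → T (good a) → toℕ x ≡ s → T i
  head-isolated (is-smaller x<s) _ x≡s = contradiction x≡s (<⇒≢ x<s)
  head-isolated (is-chosen _)    i _   = i
  head-isolated (is-larger s<x)  _ x≡s = contradiction (sym x≡s) (<⇒≢ s<x)
  head-descends : ∀ {a i} → MarkView s (toℕ x) i (descends s (toℕ x) v) a → T (good a) →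
                  ¬ Any (λ y → toℕ x < toℕ y × toℕ y < s) v
  head-descends (is-smaller _)  d asc = to (descends⇔ s (toℕ x) v) d asc
  head-descends (is-chosen x≡s) _ asc with VAny.satisfied asc
  ... | _ , x<y , y<s = <⇒≱ (<-trans x<y y<s) (≤-reflexive (sym x≡s))
  head-descends (is-larger s<x) _ asc with VAny.satisfied asc
  ... | _ , x<y , y<s = <⇒≱ (<-trans x<y y<s) (<⇒≤ s<x)

-- Distinctness separates the isolation of the head from that of letters in the tail.
tops⁺ : ∀ s k (v : Vec (Fin n) m) → Unique v → Tops s k v → T (allGood (marks s k v))
tops⁺ s k []      _          _   = tt
tops⁺ s k (x ∷ v) (x∉v ∷ v!) top = from T-∧
  ( head-good (markView s (toℕ x) (isolated k x v) (descends s (toℕ x) v)) refl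
  , tops⁺ s _ v v! record
      { isolated≤  = isolated≤ top ∘ there
      ; s-isolated = λ c∈ c≡s → tail-isolated c∈ (s-isolated top (there c∈) c≡s)
      ; no-ascent  = no-ascent top ∘ there
      })
  where
  fresh : ¬ (x ∈ v)
  fresh x∈v = VAll.lookup x∉v x∈v refl
  tail-isolated : ∀ {c} → c ∈ v → Isolated c k (x ∷ v) → Isolated c (k ⊔ suc (toℕ x)) v
  tail-isolated c∈ (here _)      = contradiction c∈ fresh
  tail-isolated c∈ (there c-iso) = c-iso
  head-isolated : Isolated x k (x ∷ v) → T (isolated k x v)
  head-isolated (here x-iso)  = x-iso
  head-isolated (there x-iso) = contradiction (isolated-∈ x-iso) fresh
  head-good : ∀ {a i} → MarkView s (toℕ x) i (descends s (toℕ x) v) a → i ≡ isolated k x v → T (good a)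
  head-good (is-smaller _)  _    = from (descends⇔ s (toℕ x) v) (no-ascent top ∘ here)
  head-good (is-chosen x≡s) refl = head-isolated (s-isolated top (here refl) x≡s)
  head-good {i = true}  (is-larger s<x) eq = contradiction (isolated≤ top (here (subst T eq tt))) (<⇒≱ s<x)
  head-good {i = false} (is-larger _)   _  = tt

greatest : ∀ {P : Fin n → Set} → Decidable P → (∀ i → ¬ P i) ⊎ ∃ λ i → P i × ∀ {j} → P j → j Fin.≤ i
greatest {zero}  P? = inj₁ λ ()
greatest {suc n} P? with greatest (P? ∘ suc) | P? zero
... | inj₂ (i , Pi , j≤i) | _      = inj₂ (suc i , Pi , λ { {zero} _ → z≤n ; {suc j} Pj → s≤s (j≤i Pj) })
... | inj₁ none           | yes P0 = inj₂ (zero , P0 , λ { {zero} _ → z≤n ; {suc j} Pj → contradiction Pj (none j) })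
... | inj₁ none           | no ¬P0 = inj₁ λ { zero → ¬P0 ; (suc i) → none i }

-- At most one summand is nonzero: the first if no letter is isolated, else the one for the largest
-- isolated letter `t`. Testing `t` suffices because an ascent below any fixed letter is also an
-- ascent below `t`.
avoids≡ : {π : Word n} → Unique π →
  ⟦ does (avoids? [12⨾3→3] π) ⟧ ≡ ⟦ n ≡ᵇ unflagged (isolations 0 π) ⟧ + ∑< n (λ s → ⟦ allGood (marks s 0 π) ⟧)
avoids≡ {n} {π} π! with greatest (λ c → hat π c ≟ c)
... | inj₁ none = begin
  ⟦ does (avoids? [12⨾3→3] π) ⟧
    ≡⟨ cong ⟦_⟧ (does≡ (avoids? [12⨾3→3] π) (mk⇔ (λ _ → tt) λ _ cont → let c , fixed , _ = to (contains⇔ π) cont in none c fixed)) ⟩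
  1 + 0
    ≡⟨ cong₂ _+_ (⟦⟧≡1 (to (none-isolated 0 π) λ c c-iso → none c (from (hat-fixed⇔isolated π! c) c-iso)))
                 (∑<-zero n λ s<n → ⟦⟧≡0 (not-top s<n)) ⟨
  ⟦ n ≡ᵇ unflagged (isolations 0 π) ⟧ + ∑< n (λ s → ⟦ allGood (marks s 0 π) ⟧) ∎
  where
  not-top : ∀ {s} → s < n → ¬ T (allGood (marks s 0 π))
  not-top s<n ok = none (fromℕ< s<n) (from (hat-fixed⇔isolated π! _)
    (s-isolated (tops⁻ _ 0 π ok) (∈-unique π! _) (toℕ-fromℕ< s<n)))
... | inj₂ (t , t-fixed , ≤t) = begin
  ⟦ does (avoids? [12⨾3→3] π) ⟧
    ≡⟨ cong ⟦_⟧ (does≡ (avoids? [12⨾3→3] π) (mk⇔ good-if-avoids avoids-if-good)) ⟩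
  ⟦ allGood (marks (toℕ t) 0 π) ⟧
    ≡⟨ cong₂ _+_ (⟦⟧≡0 λ full → from (none-isolated 0 π) full t t-isolated)
                 (∑<-single (toℕ<n t) λ s<n s≢t → ⟦⟧≡0 (s≢t ∘ only-t s<n)) ⟨
  ⟦ n ≡ᵇ unflagged (isolations 0 π) ⟧ + ∑< n (λ s → ⟦ allGood (marks s 0 π) ⟧) ∎
  where
  t-isolated : Isolated t 0 π
  t-isolated = to (hat-fixed⇔isolated π! t) t-fixed
  ≤t′ : ∀ {c} → Isolated c 0 π → toℕ c ≤ toℕ t
  ≤t′ c-iso = ≤t (from (hat-fixed⇔isolated π! _) c-iso)
  only-t : ∀ {s} → s < n → T (allGood (marks s 0 π)) → s ≡ toℕ t
  only-t {s} s<n ok = ≤-antisym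
    (subst (_≤ toℕ t) (toℕ-fromℕ< s<n) (≤t′ (s-isolated top (∈-unique π! _) (toℕ-fromℕ< s<n))))
    (isolated≤ top t-isolated)
    where top = tops⁻ s 0 π ok
  good-if-avoids : ¬ Contains π [12⨾3→3] → T (allGood (marks (toℕ t) 0 π))
  good-if-avoids avoids = tops⁺ (toℕ t) 0 π π! record
    { isolated≤  = ≤t′
    ; s-isolated = λ _ c≡t → subst (λ c → Isolated c 0 π) (sym (toℕ-injective c≡t)) t-isolated
    ; no-ascent  = λ asc → avoids (from (contains⇔ π) (t , t-fixed , asc))
    }
  avoids-if-good : T (allGood (marks (toℕ t) 0 π)) → ¬ Contains π [12⨾3→3]
  avoids-if-good ok cont with to (contains⇔ π) cont
  ... | c , c-fixed , asc = no-ascent (tops⁻ (toℕ t) 0 π ok) (ascent-mono (≤t c-fixed) asc)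

-- The final count

theorem3p1 : ∀ (n : ℕ) → n ≥ 1 →
    length (𝒮⟨ [12⨾3→3] ⟩ n)
    ≡ d n + ∑[ 1 ⋯ n ] (λ m → ∑[ 0 ⋯ n ∸ m ] (λ k →
    ((n ∸ m) C k) * ((m + k ∸ 1) C (n ∸ m)) * d k))
theorem3p1 n _ = begin
  length (𝒮⟨ [12⨾3→3] ⟩ n)
    ≡⟨ length-filter≡∑ (avoids? [12⨾3→3]) (𝒮 n) ⟩
  ∑∈ (𝒮 n) (⟦_⟧ ∘ does ∘ avoids? [12⨾3→3])
    ≡⟨ ∑∈-cong-local (All.tabulate (avoids≡ ∘ ∈-𝒮⁻ {n})) ⟩
  ∑∈ (𝒮 n) (λ π → none π + ∑< n (λ s → top s π))
    ≡⟨ ∑∈-+ (𝒮 n) none (λ π → ∑< n (λ s → top s π)) ⟩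
  ∑∈ (𝒮 n) none + ∑∈ (𝒮 n) (λ π → ∑< n (λ s → top s π))
    ≡⟨ cong₂ _+_ (trans (∑𝒮-isolations n (λ x → ⟦ n ≡ᵇ x ⟧)) (sym (d≡E n))) (∑∈-∑< n (𝒮 n) top) ⟩
  d n + ∑< n (λ s → ∑∈ (𝒮 n) (top s))
    -- The index `s` is `m ∸ 1`, the number of letters below the largest isolated one; so
    -- `n ∸ suc s` is `n ∸ m` and `s + k` is `m + k ∸ 1`.
    ≡⟨ cong (d n +_) (∑<-cong n λ {s} s<n → count-top s (n ∸ suc s) (sym (trans (+-suc s _) (m+[n∸m]≡n s<n)))) ⟩
  d n + ∑< n (λ s → ∑[ 0 ⋯ n ∸ suc s ] (summand s (n ∸ suc s)))
    ≡⟨ cong (d n +_) (∑⋯≡∑< 1 n (λ m → ∑[ 0 ⋯ n ∸ m ] (λ k → ((n ∸ m) C k) * ((m + k ∸ 1) C (n ∸ m)) * d k))) ⟨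
  _ ∎
  where
  none : Word n → ℕ
  none π = ⟦ n ≡ᵇ unflagged (isolations 0 π) ⟧
  top : ∀ {n} → ℕ → Word n → ℕ
  top s π = ⟦ allGood (marks s 0 π) ⟧
  summand : ℕ → ℕ → ℕ → ℕ
  summand s N k = (N C k) * ((s + k) C N) * d k
  -- The length is generalised so that the equation can replace it by `s + suc N`.
  count-top : ∀ {n} s N → n ≡ s + suc N → ∑∈ (𝒮 n) (top s) ≡ ∑[ 0 ⋯ N ] (summand s N)
  count-top s N refl = begin
    ∑∈ (𝒮 (s + suc N)) (top s)                         ≡⟨ ∑𝒮-allGood s N ⟩
    ∑< (suc N) (λ k → (N C k) * ((s + k) C N) * D k)
      ≡⟨ ∑<-cong (suc N) (λ {k} _ → cong ((N C k) * ((s + k) C N) *_) (D≡d k)) ⟩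
    ∑< (suc N) (summand s N)                           ≡⟨ ∑⋯≡∑< 0 N (summand s N) ⟨
    ∑[ 0 ⋯ N ] (summand s N)                           ∎
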